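{- Let $n\ge 2$, let $G$ be a finite group acting on a finite set $S$ with $|S|\ge1$, and let $T\subseteq S$ be a $G$-invariant subset such that $G$ acts trivially on $S\setminus T$. Then the poset $\mathcal{P}_n(G,S,T)\cup\{\hat 1\}$, obtained by adjoining a new top element $\hat 1$, is EL-shellable.
   Context: Let $[n]=\{1,\dots,n\}$. A partial $G$-partition of $[n]$ is a set $\tilde\beta=\{\tilde B_1,\dots,\tilde B_\ell\}$ where $\{B_1,\dots,B_\ell\}$ is a partition of a subset $\bigcup B_i\subseteq[n]$ into nonempty blocks, and each $\tilde B_i$ consists of $B_i$ with a function $b_i\colon B_i\to G$ up to $b_i\sim b_ig$ ($g\in G$). The zero block is $Z=[n]\setminus\bigcup B_i$. The $S$-Dowling poset $\mathcal{D}_n(G,S)$ is the set of pairs $(\tilde\beta,z)$, $z\colon Z\to S$, ordered by the relation generated by: (merge) $(\tilde\beta\cup\{\tilde A,\tilde B\},z)\prec(\tilde\beta\cup\{\tilde C\},z)$ with $C=A\cup B$, $c|_A=a$, $c|_B=b\cdot g$ for some $g\in G$; (color) $(\tilde\beta\cup\{\tilde B\},z)\prec(\tilde\beta,z')$ with $z'$ extending $z$ to $Z\cup B$ and $z'(i)=b(i)\cdot s$ for all $i\in B$, some $s\in S$. For a $G$-invariant $T\subseteq S$, $\mathcal{P}_n(G,S,T)=\{(\tilde\beta,z)\in\mathcal{D}_n(G,S): |z^{ -1}(O)|\neq 1\text{ for every }G\text{ -orbit }O\subseteq S\setminus T\}$ with the induced order. A bounded poset is EL-shellable if there is a labeling of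 its covering pairs by elements of some poset such that every closed interval $[x,y]$ has a unique maximal chain with strictly increasing label word, and this word lexicographically precedes those of all other maximal chains of $[x,y]$. -}

module Defs where

open import Level using (0ℓ)
open import Data.Nat using (ℕ)
open import Data.Fin using (Fin; _≟_) renaming (_≤_ to _≤ᶠ_; _<_ to _<ᶠ_)
open import Data.Fin.Subset using (Subset; _∈_; _∉_)
open import Data.Vec using (Vec; lookup; map)
open import Data.List using (List; []; _∷_)
open import Data.List.Relation.Unary.Linked using (Linked)
open import Data.List.Relation.Binary.Lex.Strict using (Lex-<)
open import Data.Product using (Σ; ∃; ∃-syntax; _×_; _,_)
open import Data.Sum using (_⊎_)
open import Data.Unit using (⊤)
open import Data.Empty using (⊥)
open import Relation.Nullary using (¬_; yes; no)
open import Relation.Binary.PropositionalEquality using (_≡_; _≢_)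
open import Relation.Binary.Bundles using (Poset)
open import Relation.Binary.Construct.Closure.ReflexiveTransitive using (Star)
open import Algebra.Core using (Op₁; Op₂)
open import Algebra.Structures using (IsGroup)

module _ {P : Set} (_≤_ : P → P → Set) where

  _<ₚ_ : P → P → Set
  x <ₚ y = (x ≤ y) × (x ≢ y)

  _⋖_ : P → P → Set
  x ⋖ y = (x <ₚ y) × (∀ z → x <ₚ z → z <ₚ y → ⊥)

  -- A maximal chain of [x , y] written as the list of its elements after x:
  -- x ⋖ z₁ ⋖ z₂ ⋖ … ⋖ zₖ = y.
  MaxChain : P → P → List P → Set
  MaxChain x y []       = x ≡ y
  MaxChain x y (z ∷ zs) = (x ⋖ z) × MaxChain z y zs

  Bounded : Set
  Bounded = Σ P λ bot → Σ P λ top → ∀ x → (bot ≤ x) × (x ≤ top)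

  module _ (Λ : Poset 0ℓ 0ℓ 0ℓ) (lab : P → P → Poset.Carrier Λ) where
    open Poset Λ renaming (Carrier to L; _≈_ to _≈ₗ_; _≤_ to _≤ₗ_)

    _<ₗ_ : L → L → Set
    a <ₗ b = (a ≤ₗ b) × ¬ (a ≈ₗ b)

    word : P → List P → List L
    word x []       = []
    word x (z ∷ zs) = lab x z ∷ word z zs

    Increasing : List L → Set
    Increasing = Linked _<ₗ_

    LexLess : List L → List L → Set
    LexLess = Lex-< _≈ₗ_ _<ₗ_

    IsELLabeling : Set
    IsELLabeling =
      ∀ x y → x ≤ y →
        Σ (List P) λ c →
          MaxChain x y c × Increasing (word x c)
          × (∀ c′ → MaxChain x y c′ → Increasing (word x c′) → c′ ≡ c)
          × (∀ c′ → MaxChain x y c′ → c′ ≢ c → LexLess (word x c) (word x c′))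

  ELShellable : Set₁
  ELShellable =
    Bounded × Σ (Poset 0ℓ 0ℓ 0ℓ) λ Λ → Σ (P → P → Poset.Carrier Λ) λ lab →
      IsELLabeling Λ lab

data WithTop (P : Set) : Set where
  elem : P → WithTop P
  top  : WithTop P

_≤̂_ : {P : Set} (_≤_ : P → P → Set) → WithTop P → WithTop P → Set
(_≤_ ≤̂ elem x) (elem y) = x ≤ y
(_≤_ ≤̂ elem x) top      = ⊤
(_≤_ ≤̂ top)    (elem y) = ⊥
(_≤_ ≤̂ top)    top      = ⊤

record FinGroupAction : Set where
  field
    m         : ℕ
    k         : ℕ
    _∙_       : Op₂ (Fin m)
    ε         : Fin m
    _⁻¹       : Op₁ (Fin m)
    isGroup   : IsGroup _≡_ _∙_ ε _⁻¹
    act       : Fin m → Fin k → Fin k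
    act-ε     : ∀ s → act ε s ≡ s
    act-∙     : ∀ g h s → act (g ∙ h) s ≡ act g (act h s)

-- S-Dowling poset D_n(G,S), with elements in a canonical form.
--
-- An element (β̃ , z) is encoded by a vector v indexed by [n]:
--   v[i] = zer s    : i lies in the zero block and z(i) = s;
--   v[i] = blk r g  : i lies in the block B whose least element is r,
--                     and b(i) = g, where the representative b of the
--                     class b ~ b·g is normalised by b(r) = ε.
-- This is a bijective encoding of D_n(G,S).

module Dowling (A : FinGroupAction) (n : ℕ) where
  open FinGroupAction A

  data Entry : Set where
    zer : Fin k → Entry
    blk : Fin n → Fin m → Entry

  Raw : Set
  Raw = Vec Entry n

  WF : Raw → Set
  WF v = ∀ i r g → lookup v i ≡ blk r g → (r ≤ᶠ i) × (lookup v r ≡ blk r ε)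

  record DElem : Set where
    constructor mkD
    field
      vec : Raw
      .wf : WF vec
  open DElem public

  -- merge the block with least element r₂ into the block with least
  -- element r₁ (r₁ < r₂): c|_A = a, c|_B = b · g
  mergeEntry : Fin n → Fin n → Fin m → Entry → Entry
  mergeEntry r₁ r₂ g (zer s)   = zer s
  mergeEntry r₁ r₂ g (blk r h) with r ≟ r₂
  ... | yes _ = blk r₁ (h ∙ g)
  ... | no  _ = blk r h

  -- colour the block with least element r: z'(i) = b(i) · s
  colorEntry : Fin n → Fin k → Entry → Entry
  colorEntry r s (zer t)    = zer t
  colorEntry r s (blk r′ h) with r′ ≟ r
  ... | yes _ = zer (act h s)
  ... | no  _ = blk r′ h

  MergeStep : Raw → Raw → Set
  MergeStep x y = ∃[ r₁ ] ∃[ r₂ ] ∃[ g ]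
    (r₁ <ᶠ r₂) × (lookup x r₁ ≡ blk r₁ ε) × (lookup x r₂ ≡ blk r₂ ε)
    × (y ≡ map (mergeEntry r₁ r₂ g) x)

  ColorStep : Raw → Raw → Set
  ColorStep x y = ∃[ r ] ∃[ s ]
    (lookup x r ≡ blk r ε) × (y ≡ map (colorEntry r s) x)

  Step : DElem → DElem → Set
  Step a b = MergeStep (vec a) (vec b) ⊎ ColorStep (vec a) (vec b)

  _≤D_ : DElem → DElem → Set
  _≤D_ = Star Step

  module _ (T : Subset k) where

    InOrbit : Fin k → Fin k → Set
    InOrbit s t = ∃[ g ] act g s ≡ t

    -- z⁻¹(O) has exactly one element, O = G·s
    ExactlyOneIn : Raw → Fin k → Set
    ExactlyOneIn v s = ∃[ i ] ((∃[ t ] (lookup v i ≡ zer t) × InOrbit s t)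
        × (∀ j t → lookup v j ≡ zer t → InOrbit s t → j ≡ i))

    InP : DElem → Set
    InP d = ∀ s → (∀ t → InOrbit s t → t ∉ T) → ¬ ExactlyOneIn (vec d) s

    record PElem : Set where
      constructor mkP
      field
        el  : DElem
        .inP : InP el
    open PElem public

    _≤P_ : PElem → PElem → Set
    p ≤P q = el p ≤D el q

    P̂ : Set
    P̂ = WithTop PElem

    _≤P̂_ : P̂ → P̂ → Set
    _≤P̂_ = _≤̂_ _≤P_

{-# OPTIONS --safe #-}

-- An element is a vector of entries, and x ≤ y iff y_i = b(i) · y_r whenever i lies in the block
-- of x with minimum r and normalised labelling b.  A covering step absorbs one block minimum p
-- by giving it an entry e (a merge if e lies in another block, a colouring if e lies in the zero
-- block), and such a step stays below y iff y_p is the value forced by e.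
--
-- Fix a colour s₁, taken in T if T ≠ ∅.  Steps are labelled, in lexicographic order, by
--   (0 , p , 0)        merging the block of p with g = ε;
--   (1 , s , 0)        colouring with a colour s already in use, if T = ∅;
--   (2 , rank s , 0)   any other colouring, where s₁ has rank 0 and the other ranks are ≥ 2;
--   (3 , r , g)        merging into the block of r with g ≠ ε;
-- and a maximal element is joined to the top by (2 , 1 , 0), or by (1 , least colour used , 1)
-- if T = ∅ and some colour other than s₁ is used.
-- In an interval [x , y] the step a of least label is unique, every step following a has a larger
-- label, and after any step b ≠ a some step has a label at most that of b.  Hence the greedy
-- chain is the only increasing one and comes first lexicographically.
-- The labels with first entry 1 are needed because for T = ∅ a last block that is a singleton
-- can only receive a colour already in use.

module Submission where

open import Defs
open import Level using (0ℓ)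
open import Data.Nat using (ℕ; zero; suc; _+_; _≤_; _<_; z≤n; s≤s)
import Data.Nat.Properties as ℕ
open import Data.Nat.Induction using (<-wellFounded)
open import Induction.WellFounded using (Acc; acc)
open import Data.Fin using (Fin; zero; suc; _≟_; toℕ; fromℕ<) renaming (_≤_ to _≤ᶠ_; _<_ to _<ᶠ_)
import Data.Fin.Properties as F
open import Data.Fin.Subset using (Subset; _∈_; _∉_; ∣_∣)
open import Data.Fin.Subset.Properties using (_∈?_; nonempty?; p⊂q⇒∣p∣<∣q∣)
open import Data.List using (List; []; _∷_)
open import Data.List.Relation.Unary.Linked using ([]; [-]; _∷_)
open import Data.List.Relation.Binary.Lex.Strict using (this; next)
open import Data.Vec using (lookup; map; tabulate)
open import Data.Vec.Properties using (lookup-map; lookup∘tabulate; tabulate∘lookup; tabulate-cong; lookup⇒[]=; []=⇒lookup; ≡-dec)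
open import Data.Product using (Σ; ∃; ∃-syntax; _×_; _,_; proj₁; proj₂)
open import Data.Product.Relation.Binary.Lex.Strict using (×-strictTotalOrder)
open import Data.Sum using (_⊎_; inj₁; inj₂)
open import Data.Unit using (⊤; tt)
open import Data.Empty using (⊥; ⊥-elim; ⊥-elim-irr)
open import Algebra.Bundles using (Group)
open import Algebra.Structures using (IsGroup)
import Algebra.Properties.Group as GroupProperties
open import Relation.Nullary using (¬_; Dec; yes; no; contradiction; does)
open import Relation.Nullary.Decidable using (recompute; _×-dec_; dec-true; ¬?; map′)
open import Relation.Binary.Bundles using (Poset; StrictTotalOrder)
open import Relation.Binary.Definitions using (Reflexive; Transitive; Antisymmetric; DecidableEquality; tri<; tri≈; tri>)
open import Relation.Binary.PropositionalEquality using (_≡_; _≢_; refl; sym; trans; cong; subst; subst₂)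
open import Relation.Binary.Properties.StrictPartialOrder using (poset)
import Relation.Binary.Construct.StrictToNonStrict as ToNonStrict
open import Relation.Binary.Construct.Closure.ReflexiveTransitive using (ε; _◅_; _◅◅_)

-- A criterion for EL-labelings by greedy first steps

module ELCriterion {P : Set} (_⊑_ : P → P → Set) (Λ : Poset 0ℓ 0ℓ 0ℓ) (lab : P → P → Poset.Carrier Λ) where
  open Poset Λ using () renaming (_≤_ to _≼_; trans to ≼-trans; antisym to ≼-antisym; module Eq to ≈)

  infix 4 _⋖ᵖ_ _≺ᵖ_

  _⋖ᵖ_ : P → P → Set
  _⋖ᵖ_ = _⋖_ _⊑_

  _≺ᵖ_ : Poset.Carrier Λ → Poset.Carrier Λ → Set
  _≺ᵖ_ = _<ₗ_ _⊑_ Λ lab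

  Chain : P → P → List P → Set
  Chain = MaxChain _⊑_

  Rising : P → List P → Set
  Rising x c = Increasing _⊑_ Λ lab (word _⊑_ Λ lab x c)

  ELChain : P → P → Set
  ELChain x y = Σ (List P) λ c → Chain x y c × Rising x c
    × (∀ c′ → Chain x y c′ → Rising x c′ → c′ ≡ c)
    × (∀ c′ → Chain x y c′ → c′ ≢ c → LexLess _⊑_ Λ lab (word _⊑_ Λ lab x c) (word _⊑_ Λ lab x c′))

  -- `ascent` makes the greedy chain increasing, `least` puts it first lexicographically, and
  -- `descent` rules out increasing chains with another first step.
  record Greedy (x y : P) : Set where
    field
      atom    : P
      covers  : x ⋖ᵖ atom
      below   : atom ⊑ y
      least   : ∀ b → x ⋖ᵖ b → b ⊑ y → b ≢ atom → lab x atom ≺ᵖ lab x b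
      ascent  : ∀ c → atom ⋖ᵖ c → c ⊑ y → lab x atom ≺ᵖ lab atom c
      descent : ∀ b → x ⋖ᵖ b → b ⊑ y → b ≢ atom → ∃[ c ] b ⋖ᵖ c × c ⊑ y × lab b c ≼ lab x b
  open Greedy

  module _ (_≟ₚ_ : DecidableEquality P)
           (⊑-refl : Reflexive _⊑_) (⊑-trans : Transitive _⊑_) (⊑-antisym : Antisymmetric _≡_ _⊑_)
           (rank : P → ℕ) (rank-⋖ : ∀ {x y} → x ⋖ᵖ y → rank y < rank x)
           (greedy : ∀ x y → x ⊑ y → x ≢ y → Greedy x y)
    where

    chain-⊑ : ∀ {x y} c → Chain x y c → x ⊑ y
    chain-⊑ []      refl      = ⊑-refl
    chain-⊑ (z ∷ c) (x⋖z , m) = ⊑-trans (proj₁ (proj₁ x⋖z)) (chain-⊑ c m)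

    ⋖-no-return : ∀ {x z} → x ⋖ᵖ z → z ⊑ x → ⊥
    ⋖-no-return ((x⊑z , x≢z) , _) z⊑x = x≢z (⊑-antisym x⊑z z⊑x)

    -- Induction on the chain. If `b` were another step, `descent` would give `d` with
    -- `lab b d ≼ lab x b`. The rest of the chain is increasing, so its head `e` is the greedy atom
    -- above `b`, and `lab b e ≼ lab b d ≼ lab x b` contradicts the ascent at `b`.
    increasing-head : ∀ {x y} b c → Chain x y (b ∷ c) → Rising x (b ∷ c)
                    → (G : Greedy x y) → b ≡ atom G
    increasing-head {x} {y} b c (x⋖b , m) inc G with b ≟ₚ atom G
    ... | yes b≡a = b≡a
    ... | no b≢a with descent G b x⋖b (chain-⊑ c m) b≢a
    increasing-head b []       (x⋖b , refl)    inc G         | no b≢a | d , b⋖d , d⊑y , d≼ =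
      ⊥-elim (⋖-no-return b⋖d d⊑y)
    increasing-head {x} {y} b (e ∷ c) (x⋖b , b⋖e , m) (x≺e ∷ inc) G | no b≢a | d , b⋖d , d⊑y , d≼ =
      ⊥-elim (proj₂ x≺e (≼-antisym (proj₁ x≺e) (≼-trans e≼d d≼)))
      where
      H : Greedy b y
      H = greedy b y (chain-⊑ (e ∷ c) (b⋖e , m)) (λ { refl → ⋖-no-return b⋖d d⊑y })
      e≡a : e ≡ atom H
      e≡a = increasing-head e c (b⋖e , m) inc H
      e≼d : lab b e ≼ lab b d
      e≼d with d ≟ₚ atom H
      ... | yes d≡a = Poset.reflexive Λ (≈.reflexive (cong (lab b) (trans e≡a (sym d≡a))))
      ... | no d≢a  = subst (λ z → lab b z ≼ lab b d) (sym e≡a) (proj₁ (least H d b⋖d d⊑y d≢a))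

    greedy-EL : IsELLabeling _⊑_ Λ lab
    greedy-EL x y x⊑y = go x x⊑y (<-wellFounded (rank x))
      where
      go : ∀ x → x ⊑ y → Acc _<_ (rank x) → ELChain x y
      go x x⊑y (acc rs) with x ≟ₚ y
      ... | yes refl = [] , refl , [] , only , λ c′ m c′≢[] → contradiction (trivial c′ m) c′≢[]
        where
        trivial : ∀ c′ → Chain x x c′ → c′ ≡ []
        trivial []       m         = refl
        trivial (z ∷ c′) (x⋖z , m) = ⊥-elim (⋖-no-return x⋖z (chain-⊑ c′ m))
        only : ∀ c′ → Chain x x c′ → _ → c′ ≡ []
        only c′ m _ = trivial c′ m
      ... | no x≢y = extend (go (atom G) (below G) (rs (rank-⋖ (covers G))))
        where
        G : Greedy x y
        G = greedy x y x⊑y x≢y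
        extend : ELChain (atom G) y → ELChain x y
        extend (c , m , inc , uniq , lex) = atom G ∷ c , (covers G , m) , increasing c m inc , uniq′ , lex′
          where
          increasing : ∀ c → Chain (atom G) y c → Rising (atom G) c → Rising x (atom G ∷ c)
          increasing []      m         inc = [-]
          increasing (d ∷ c) (a⋖d , m) inc = ascent G d a⋖d (chain-⊑ c m) ∷ inc
          tail-increasing : ∀ {z} c → Rising x (z ∷ c) → Rising z c
          tail-increasing []      _       = []
          tail-increasing (_ ∷ _) (_ ∷ i) = i
          uniq′ : ∀ c′ → Chain x y c′ → Rising x c′ → c′ ≡ atom G ∷ c
          uniq′ []       m′         _    = ⊥-elim (x≢y m′)
          uniq′ (b ∷ c′) m′ inc′ with increasing-head b c′ m′ inc′ G
          ... | refl = cong (atom G ∷_) (uniq c′ (proj₂ m′) (tail-increasing c′ inc′))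
          lex′ : ∀ c′ → Chain x y c′ → c′ ≢ atom G ∷ c
               → LexLess _⊑_ Λ lab (word _⊑_ Λ lab x (atom G ∷ c)) (word _⊑_ Λ lab x c′)
          lex′ []       m′         _  = ⊥-elim (x≢y m′)
          lex′ (b ∷ c′) (x⋖b , m′) ne with b ≟ₚ atom G
          ... | yes refl = next ≈.refl (lex c′ m′ (λ eq → ne (cong (atom G ∷_) eq)))
          ... | no b≢a   = this (least G b x⋖b (chain-⊑ c′ m′) b≢a)

-- Lexicographically ordered labels

Label : Set
Label = ℕ × ℕ × ℕ

labelOrder : StrictTotalOrder 0ℓ 0ℓ 0ℓ
labelOrder = ×-strictTotalOrder ℕ.<-strictTotalOrder (×-strictTotalOrder ℕ.<-strictTotalOrder ℕ.<-strictTotalOrder)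

open StrictTotalOrder labelOrder using (strictPartialOrder)
  renaming (_<_ to _≺_; irrefl to ≺-irrefl; trans to ≺-trans; compare to ≺-compare)

labelPoset : Poset 0ℓ 0ℓ 0ℓ
labelPoset = poset strictPartialOrder

open Poset labelPoset using () renaming (_≈_ to _≈ₗ_; _≤_ to _≼_; refl to ≼-refl; trans to ≼-trans)

≼-total : ∀ a b → (a ≼ b) ⊎ (b ≼ a)
≼-total = ToNonStrict.total _≈ₗ_ _≺_ ≺-compare

by-1st : ∀ {c c′ a a′ b b′} → c < c′ → (c , a , b) ≺ (c′ , a′ , b′)
by-1st = inj₁

by-2nd : ∀ {c a a′ b b′} → a < a′ → (c , a , b) ≺ (c , a′ , b′)
by-2nd a<a′ = inj₂ (refl , inj₁ a<a′)

by-3rd : ∀ {c a b b′} → b < b′ → (c , a , b) ≺ (c , a , b′)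
by-3rd b<b′ = inj₂ (refl , inj₂ (refl , b<b′))

-- Only indices satisfying `Q` are compared, so `f` may take any value elsewhere.
argmin : ∀ {N} {Q : Fin N → Set} → (∀ i → Dec (Q i)) → (f : Fin N → Label)
       → (∃[ i ] Q i × (∀ j → Q j → f i ≼ f j)) ⊎ (∀ i → ¬ Q i)
argmin {zero}  Q? f = inj₂ λ ()
argmin {suc N} Q? f with Q? zero | argmin (λ i → Q? (suc i)) (λ i → f (suc i))
... | no ¬q | inj₁ (i , q , min) = inj₁ (suc i , q , λ { zero q₀ → ⊥-elim (¬q q₀) ; (suc j) qj → min j qj })
... | no ¬q | inj₂ none = inj₂ λ { zero → ¬q ; (suc i) → none i }
... | yes q | inj₂ none = inj₁ (zero , q , λ { zero _ → ≼-refl {f zero} ; (suc j) qj → ⊥-elim (none j qj) })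
... | yes q | inj₁ (i , qi , min) with ≼-total (f zero) (f (suc i))
... | inj₁ 0≼i = inj₁ (zero , q , λ { zero _ → ≼-refl {f zero} ; (suc j) qj → ≼-trans 0≼i (min j qj) })
... | inj₂ i≼0 = inj₁ (suc i , qi , λ { zero _ → i≼0 ; (suc j) qj → min j qj })

≼-2nd⁻ : ∀ {c a a′ b} → (c , a , b) ≼ (c , a′ , b) → a ≤ a′
≼-2nd⁻ (inj₁ (inj₁ c<c)) = contradiction c<c (ℕ.<-irrefl refl)
≼-2nd⁻ (inj₁ (inj₂ (_ , inj₁ a<a′))) = ℕ.<⇒≤ a<a′
≼-2nd⁻ (inj₁ (inj₂ (_ , inj₂ (_ , b<b)))) = contradiction b<b (ℕ.<-irrefl refl)
≼-2nd⁻ (inj₂ (_ , a≡a′ , _)) = ℕ.≤-reflexive a≡a′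

≡⇒≼ : ∀ {a b : Label} → a ≡ b → a ≼ b
≡⇒≼ {a} refl = ≼-refl {a}

≼∧≢⇒≺ : ∀ {a b : Label} → a ≼ b → a ≢ b → a ≺ b
≼∧≢⇒≺ (inj₁ a≺b) _ = a≺b
≼∧≢⇒≺ (inj₂ (refl , refl , refl)) a≢b = contradiction refl a≢b

≼-≺-trans : ∀ {a b c : Label} → a ≼ b → b ≺ c → a ≺ c
≼-≺-trans {a} {b} {c} (inj₁ a≺b) b≺c = ≺-trans {a} {b} {c} a≺b b≺c
≼-≺-trans (inj₂ (refl , refl , refl)) b≺c = b≺c

≺-≼-trans : ∀ {a b c : Label} → a ≺ b → b ≼ c → a ≺ c
≺-≼-trans {a} {b} {c} a≺b (inj₁ b≺c) = ≺-trans {a} {b} {c} a≺b b≺c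
≺-≼-trans a≺b (inj₂ (refl , refl , refl)) = a≺b

-- Dowling posets

module Structure (A : FinGroupAction) (n : ℕ) where
  open FinGroupAction A renaming (ε to e₀)
  open IsGroup isGroup using (assoc; identityˡ; identityʳ)
  open Dowling A n

  blk-injective : ∀ {r r′ g g′} → blk r g ≡ blk r′ g′ → r ≡ r′ × g ≡ g′
  blk-injective refl = refl , refl

  zer-injective : ∀ {s t} → zer s ≡ zer t → s ≡ t
  zer-injective refl = refl

  infix 4 _≟ᴱ_
  _≟ᴱ_ : DecidableEquality Entry
  zer s   ≟ᴱ zer t     = map′ (cong zer) zer-injective (s ≟ t)
  zer s   ≟ᴱ blk r g   = no λ ()
  blk r g ≟ᴱ zer s     = no λ ()
  blk r g ≟ᴱ blk r′ g′ = map′ (λ { (refl , refl) → refl }) blk-injective (r ≟ r′ ×-dec g ≟ g′)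

  infix 8 _!_
  _!_ : DElem → Fin n → Entry
  x ! i = lookup (vec x) i

  wf! : ∀ x → WF (vec x)
  wf! (mkD v w) i r g eq = recompute (r F.≤? i ×-dec lookup v r ≟ᴱ blk r e₀) (w i r g eq)

  ≡-of-vec : ∀ {x y} → vec x ≡ vec y → x ≡ y
  ≡-of-vec {mkD v _} {mkD .v _} refl = refl

  vec-ext : {v w : Raw} → (∀ i → lookup v i ≡ lookup w i) → v ≡ w
  vec-ext {v} {w} eq = trans (sym (tabulate∘lookup v)) (trans (tabulate-cong eq) (tabulate∘lookup w))

  ≡-of-! : ∀ {x y} → (∀ i → x ! i ≡ y ! i) → x ≡ y
  ≡-of-! eq = ≡-of-vec (vec-ext eq)

  _≟ᴰ_ : DecidableEquality DElem
  x ≟ᴰ y = map′ ≡-of-vec (cong vec) (≡-dec _≟ᴱ_ (vec x) (vec y))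

  infixr 7 _•_
  _•_ : Fin m → Entry → Entry
  h • zer s   = zer (act h s)
  h • blk r g = blk r (h ∙ g)

  •-ε : ∀ e → e₀ • e ≡ e
  •-ε (zer s)   = cong zer (act-ε s)
  •-ε (blk r g) = cong (blk r) (identityˡ g)

  •-∙ : ∀ g h e → (g ∙ h) • e ≡ g • h • e
  •-∙ g h (zer s)   = cong zer (act-∙ g h s)
  •-∙ g h (blk r k) = cong (blk r) (assoc g h k)

  -- The value forced on a coordinate carrying the entry e, given the values of y at the
  -- block minima: c|_B = b · g and z|_B = b · s are the same formula.
  ext : DElem → Entry → Entry
  ext y (zer s)   = zer s
  ext y (blk r g) = g • y ! r

  ext-• : ∀ y h e → ext y (h • e) ≡ h • ext y e
  ext-• y h (zer s)   = refl
  ext-• y h (blk r g) = •-∙ h g (y ! r)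

  infix 4 _⊑_
  -- On P this is the order itself, by `≤D⇒⊑` and `⊑⇒≤D`.
  record _⊑_ (x y : DElem) : Set where
    constructor mk⊑
    field at : ∀ i → y ! i ≡ ext y (x ! i)
  open _⊑_ public

  ⊑-blk : ∀ {x y i r h} → x ⊑ y → x ! i ≡ blk r h → y ! i ≡ h • y ! r
  ⊑-blk {x} {y} {i} l eq = trans (at l i) (cong (ext y) eq)

  ⊑-zer : ∀ {x y i s} → x ⊑ y → x ! i ≡ zer s → y ! i ≡ zer s
  ⊑-zer {x} {y} {i} l eq = trans (at l i) (cong (ext y) eq)

  IsMin : DElem → Fin n → Set
  IsMin x r = x ! r ≡ blk r e₀

  IsMin? : ∀ x r → Dec (IsMin x r)
  IsMin? x r = x ! r ≟ᴱ blk r e₀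

  block-min : ∀ x {i r h} → x ! i ≡ blk r h → IsMin x r
  block-min x eq = proj₂ (wf! x _ _ _ eq)

  block-≤ : ∀ x {i r h} → x ! i ≡ blk r h → r ≤ᶠ i
  block-≤ x eq = proj₁ (wf! x _ _ _ eq)

  ext-blk : ∀ y {r} h → IsMin y r → h • y ! r ≡ blk r h
  ext-blk y {r} h eq = trans (cong (h •_) eq) (cong (blk r) (identityʳ h))

  ⊑-refl : ∀ {x} → x ⊑ x
  ⊑-refl {x} .at i with x ! i in eq
  ... | zer s   = refl
  ... | blk r h = sym (ext-blk x h (block-min x eq))

  ⊑-trans : ∀ {x y z} → x ⊑ y → y ⊑ z → x ⊑ z
  ⊑-trans {x} {y} {z} l l′ .at i with x ! i in eq
  ... | zer s   = ⊑-zer l′ (⊑-zer l eq)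
  ... | blk r h = trans (at l′ i) (trans (cong (ext z) (⊑-blk l eq))
                    (trans (ext-• z h (y ! r)) (cong (h •_) (sym (at l′ r)))))

  -- If `x` has `r` in the block of `q`, then `q ≤ r`. The value of `y` at `r` is a translate of
  -- that at `q`, so `q` lies in the block of `r` in `y` and `r ≤ q`.
  ⊑-min : ∀ {x y r} → x ⊑ y → IsMin y r → IsMin x r
  ⊑-min {x} {y} {r} l min with x ! r in eq
  ... | zer s   = contradiction (trans (sym (⊑-zer l eq)) min) λ ()
  ... | blk q h with y ! q in eqq | trans (sym (⊑-blk l eq)) min
  ... | zer s | ()
  ... | blk r′ g | e with proj₁ (blk-injective e)
  ... | refl with F.≤-antisym (block-≤ x eq) (block-≤ y eqq)
  ... | refl = trans (sym eq) (block-min x eq)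

  -- The values of `y` at the minima of `x` determine `y`, and a surviving minimum has its
  -- normalised value.
  ⊑-mins-≡ : ∀ {x y} → x ⊑ y → (∀ r → IsMin x r → IsMin y r) → x ≡ y
  ⊑-mins-≡ {x} {y} l mins = ≡-of-! λ i → sym (pt i)
    where
    pt : ∀ i → y ! i ≡ x ! i
    pt i with x ! i in eq
    ... | zer s   = ⊑-zer l eq
    ... | blk r h = trans (⊑-blk l eq) (ext-blk y h (mins r (block-min x eq)))

  ⊑-antisym : ∀ {x y} → x ⊑ y → y ⊑ x → x ≡ y
  ⊑-antisym l l′ = ⊑-mins-≡ l λ r → ⊑-min l′

  lost-min : ∀ {x y} → x ⊑ y → x ≢ y → ∃[ r ] IsMin x r × ¬ IsMin y r
  lost-min {x} {y} l x≢y with F.any? (λ r → IsMin? x r ×-dec ¬? (IsMin? y r))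
  ... | yes p = p
  ... | no ¬p = contradiction (⊑-mins-≡ l keep) x≢y
    where
    keep : ∀ r → IsMin x r → IsMin y r
    keep r min with IsMin? y r
    ... | yes min′ = min′
    ... | no ¬min  = contradiction (r , min , ¬min) ¬p

  -- Its cardinality, the number of nonzero blocks, is the measure for inductions up the order.
  minima : DElem → Subset n
  minima x = tabulate λ r → does (IsMin? x r)

  ∈-minima⁺ : ∀ {x r} → IsMin x r → r ∈ minima x
  ∈-minima⁺ {x} {r} min = lookup⇒[]= r _ (trans (lookup∘tabulate _ r) (dec-true (IsMin? x r) min))

  ∈-minima⁻ : ∀ {x r} → r ∈ minima x → IsMin x r
  ∈-minima⁻ {x} {r} mem with IsMin? x r | trans (sym (lookup∘tabulate (λ q → does (IsMin? x q)) r)) ([]=⇒lookup mem)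
  ... | yes min | _ = min
  ... | no _    | ()

  rank-⊑ : ∀ {x y} → x ⊑ y → x ≢ y → ∣ minima y ∣ < ∣ minima x ∣
  rank-⊑ {x} {y} l x≢y with lost-min l x≢y
  ... | r , min , ¬min = p⊂q⇒∣p∣<∣q∣
    ( (λ mem → ∈-minima⁺ {x} (⊑-min l (∈-minima⁻ {y} mem)))
    , r , ∈-minima⁺ {x} min , λ mem → ¬min (∈-minima⁻ {y} mem))

  -- Moves: single merges and colourings

  update : Fin n → Entry → Entry → Entry
  update p e (zer s) = zer s
  update p e (blk r h) with r ≟ p
  -- This is `blk r (h ∙ g)` for a merge and `zer (act h s)` for a colouring.
  ... | yes _ = h • e
  ... | no  _ = blk r h

  update-hit : ∀ p e h → update p e (blk p h) ≡ h • e
  update-hit p e h with p ≟ p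
  ... | yes _  = refl
  ... | no p≢p = contradiction refl p≢p

  update-miss : ∀ {p r} e h → r ≢ p → update p e (blk r h) ≡ blk r h
  update-miss {p} {r} e h r≢p with r ≟ p
  ... | yes r≡p = contradiction r≡p r≢p
  ... | no _    = refl

  Target : DElem → Fin n → Entry → Set
  Target x p (zer s)   = ⊤
  Target x p (blk r g) = r <ᶠ p × IsMin x r

  -- b arises from x by absorbing the block with minimum p, whose minimum receives the entry e:
  -- e = blk r g is a merge and e = zer s is a colouring.
  record Move (x : DElem) (p : Fin n) (e : Entry) (b : DElem) : Set where
    field
      min    : IsMin x p
      target : Target x p e
      result : ∀ i → b ! i ≡ update p e (x ! i)

  module MoveProperties {x p e b} (M : Move x p e b) where
    open Move M public

    result-zer : ∀ {i s} → x ! i ≡ zer s → b ! i ≡ zer s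
    result-zer {i} eq = trans (result i) (cong (update p e) eq)

    result-hit : ∀ {i h} → x ! i ≡ blk p h → b ! i ≡ h • e
    result-hit {i} {h} eq = trans (result i) (trans (cong (update p e) eq) (update-hit p e h))

    result-miss : ∀ {i r h} → r ≢ p → x ! i ≡ blk r h → b ! i ≡ blk r h
    result-miss {i} {r} {h} r≢p eq = trans (result i) (trans (cong (update p e) eq) (update-miss e h r≢p))

    result-pos : b ! p ≡ e
    result-pos = trans (result-hit min) (•-ε e)

    target-≢ : ∀ {g} → e ≢ blk p g
    target-≢ refl = F.<-irrefl refl (proj₁ target)

    min-lost : ¬ IsMin b p
    min-lost eq = target-≢ (trans (sym result-pos) eq)

    min-kept : ∀ {r} → IsMin x r → r ≢ p → IsMin b r
    min-kept eq r≢p = result-miss r≢p eq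

    move-⊑ : x ⊑ b
    move-⊑ .at i with x ! i in eq
    ... | zer s = result-zer eq
    ... | blk r h with r ≟ p
    ... | yes refl = trans (result-hit eq) (cong (h •_) (sym result-pos))
    ... | no r≢p   = trans (result-miss r≢p eq) (sym (ext-blk b h (min-kept (block-min x eq) r≢p)))

    min-old : ∀ {r} → IsMin b r → IsMin x r
    min-old = ⊑-min move-⊑

    min-new-≢ : ∀ {r} → IsMin b r → r ≢ p
    min-new-≢ eq refl = min-lost eq

    move-≢ : x ≢ b
    move-≢ refl = min-lost min

    lost-only : ∀ {r} → IsMin x r → ¬ IsMin b r → r ≡ p
    lost-only {r} min ¬min with r ≟ p
    ... | yes eq = eq
    ... | no r≢p = contradiction (min-kept min r≢p) ¬min

    below-value : ∀ {y} → b ⊑ y → y ! p ≡ ext y e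
    below-value {y} l = trans (at l p) (cong (ext y) result-pos)

    -- Only the block of `p` changes, and there the forced value `h • ext y e` agrees with
    -- `h • y ! p`.
    move-below : ∀ {y} → x ⊑ y → y ! p ≡ ext y e → b ⊑ y
    move-below {y} l eqp .at i with x ! i in eq
    ... | zer s = trans (⊑-zer l eq) (sym (cong (ext y) (result-zer eq)))
    ... | blk r h with r ≟ p
    ... | no r≢p   = trans (⊑-blk l eq) (sym (cong (ext y) (result-miss r≢p eq)))
    ... | yes refl = trans (⊑-blk l eq) (trans (cong (h •_) eqp)
                       (trans (sym (ext-• y h e)) (sym (cong (ext y) (result-hit eq)))))

    -- Each strict step up loses a minimum and the move loses only `p`, so an element strictly
    -- between would have `p` lost twice.
    move-tight : ∀ {z} → x ⊑ z → x ≢ z → z ⊑ b → z ≢ b → ⊥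
    move-tight l x≢z l′ z≢b with lost-min l x≢z | lost-min l′ z≢b
    ... | r , rx , ¬rz | q , qz , ¬qb
      with lost-only rx (λ rb → ¬rz (⊑-min l′ rb)) | lost-only (⊑-min l qz) ¬qb
    ... | refl | refl = ¬rz qz

  move-functional : ∀ {x p e b b′} → Move x p e b → Move x p e b′ → b ≡ b′
  move-functional M M′ = ≡-of-! λ i → trans (Move.result M i) (sym (Move.result M′ i))

  update-vec : ∀ {v w : Raw} (f : Entry → Entry) → w ≡ map f v → ∀ i → lookup w i ≡ f (lookup v i)
  update-vec {v} f refl i = lookup-map i f v

  mergeEntry≡update : ∀ r p g e → mergeEntry r p g e ≡ update p (blk r g) e
  mergeEntry≡update r p g (zer s) = refl
  mergeEntry≡update r p g (blk q h) with q ≟ p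
  ... | yes _ = refl
  ... | no  _ = refl

  colorEntry≡update : ∀ p s e → colorEntry p s e ≡ update p (zer s) e
  colorEntry≡update p s (zer t) = refl
  colorEntry≡update p s (blk q h) with q ≟ p
  ... | yes _ = refl
  ... | no  _ = refl

  step⇒move : ∀ {x b} → Step x b → ∃[ p ] ∃[ e ] Move x p e b
  step⇒move {x} (inj₁ (r , p , g , r<p , minr , minp , eq)) = p , blk r g , record
    { min = minp ; target = r<p , minr
    ; result = λ i → trans (update-vec (mergeEntry r p g) eq i) (mergeEntry≡update r p g (x ! i)) }
  step⇒move {x} (inj₂ (p , s , minp , eq)) = p , zer s , record
    { min = minp ; target = tt
    ; result = λ i → trans (update-vec (colorEntry p s) eq i) (colorEntry≡update p s (x ! i)) }

  move⇒step : ∀ {x p e b} → Move x p e b → Step x b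
  move⇒step {x} {p} {zer s} M = inj₂ (p , s , Move.min M , vec-ext λ i →
    trans (Move.result M i) (trans (sym (colorEntry≡update p s (x ! i))) (sym (lookup-map i _ (vec x)))))
  move⇒step {x} {p} {blk r g} M = inj₁ (r , p , g
    , proj₁ (Move.target M) , proj₂ (Move.target M) , Move.min M , vec-ext λ i →
    trans (Move.result M i) (trans (sym (mergeEntry≡update r p g (x ! i))) (sym (lookup-map i _ (vec x)))))

  ≤D⇒⊑ : ∀ {x y} → x ≤D y → x ⊑ y
  ≤D⇒⊑ ε = ⊑-refl
  ≤D⇒⊑ {x} (_◅_ {j = b} st sts) with step⇒move {x} {b} st
  ... | _ , _ , M = ⊑-trans (MoveProperties.move-⊑ M) (≤D⇒⊑ sts)

  •-target : ∀ {h e r g} → h • e ≡ blk r g → ∃[ g′ ] e ≡ blk r g′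
  •-target {e = blk r g} refl = g , refl

  private
    update-WF : ∀ x p e → IsMin x p → Target x p e → WF (map (update p e) (vec x))
    update-WF x p e min tgt i r g eq with x ! i in eqi | trans (sym (lookup-map i (update p e) (vec x))) eq
    ... | zer s   | ()
    ... | blk q h | eq′ with q ≟ p
    ... | no q≢p with eq′
    ... | refl = block-≤ x eqi
               , trans (lookup-map q _ (vec x)) (trans (cong (update p e) (block-min x eqi)) (update-miss e e₀ q≢p))
    update-WF x p e min tgt i r g eq | blk q h | eq′ | yes refl with •-target {e = e} eq′
    ... | g′ , refl = F.≤-trans (ℕ.<⇒≤ (proj₁ tgt)) (block-≤ x eqi)
               , trans (lookup-map r _ (vec x)) (trans (cong (update p e) (proj₂ tgt))
                   (update-miss (blk r g′) e₀ λ { refl → F.<-irrefl refl (proj₁ tgt) }))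

  move : ∀ x p e → IsMin x p → Target x p e → ∃[ b ] Move x p e b
  move x p e min tgt = mkD (map (update p e) (vec x)) (update-WF x p e min tgt)
                     , record { min = min ; target = tgt ; result = λ i → lookup-map i _ (vec x) }

  bottom : DElem
  bottom = mkD (tabulate λ i → blk i e₀) λ i r g eq → go i r g (trans (sym (lookup∘tabulate _ i)) eq)
    where
    go : ∀ i r g → blk i e₀ ≡ blk r g → r ≤ᶠ i × lookup (tabulate λ j → blk j e₀) r ≡ blk r e₀
    go i _ _ refl = F.≤-refl , lookup∘tabulate _ i

  bottom-! : ∀ i → bottom ! i ≡ blk i e₀
  bottom-! i = lookup∘tabulate _ i

  bottom-⊑ : ∀ y → bottom ⊑ y
  bottom-⊑ y .at i = sym (trans (cong (ext y) (bottom-! i)) (•-ε (y ! i)))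

-- The labelling of P_n(G,S,T)

module Labelling (A : FinGroupAction) (n : ℕ) (T : Subset (FinGroupAction.k A))
  (T-invariant : ∀ g t → t ∈ T → FinGroupAction.act A g t ∈ T)
  (trivial : ∀ g s → s ∉ T → FinGroupAction.act A g s ≡ s)
  (s₁ : Fin (FinGroupAction.k A)) (T-empty : s₁ ∉ T → ∀ s → s ∉ T)
  where
  open FinGroupAction A renaming (ε to e₀)
  open IsGroup isGroup using (inverseˡ)

  group : Group 0ℓ 0ℓ
  group = record { isGroup = isGroup }

  open GroupProperties group using (identityˡ-unique)
  open Dowling A n
  open Structure A n

  -- Membership in P and the moves that preserve it

  Paired : DElem → Set
  Paired x = ∀ s i → s ∉ T → x ! i ≡ zer s → ∃[ j ] j ≢ i × x ! j ≡ zer s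

  -- Outside `T` every orbit is a single colour. Membership is irrelevant data, so the second
  -- coordinate comes from a finite search and membership only refutes its failure.
  InP⇒Paired : (x : PElem T) → Paired (el x)
  InP⇒Paired (mkP x p) s i s∉T eq with F.any? (λ j → ¬? (j ≟ i) ×-dec x ! j ≟ᴱ zer s)
  ... | yes found = found
  ... | no none   = ⊥-elim-irr (p s (λ { _ (g , refl) gs∈T → s∉T (subst (_∈ T) (trivial g s s∉T) gs∈T) })
                                  (i , (s , eq , e₀ , act-ε s) , only))
    where
    only : ∀ j t → x ! j ≡ zer t → InOrbit T s t → j ≡ i
    only j _ eqj (g , refl) with j ≟ i
    ... | yes j≡i = j≡i
    ... | no j≢i  = contradiction (j , j≢i , trans eqj (cong zer (trivial g s s∉T))) none

  Paired⇒InP : ∀ x → Paired x → InP T x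
  Paired⇒InP x paired s s∉T (i , (_ , eq , g , refl) , only)
    with paired s i s∉ (trans eq (cong zer (trivial g s s∉)))
    where s∉ = s∉T s (e₀ , act-ε s)
  ... | j , j≢i , eqj = j≢i (only j s eqj (e₀ , act-ε s))

  -- A colour outside `T` needs a carrier other than `p`: a coordinate already coloured `s`, or
  -- another element of the block, which also receives `s` because `s` is fixed by the action.
  Allowed : DElem → Fin n → Entry → Set
  Allowed x p (zer s)   = s ∉ T → ∃[ j ] j ≢ p × (x ! j ≡ zer s ⊎ ∃[ h ] x ! j ≡ blk p h)
  Allowed x p (blk r g) = ⊤

  -- By invariance `t` cannot lie in `T`, so `h` fixes it.
  untwist : ∀ {h t s} → s ∉ T → act h t ≡ s → t ≡ s
  untwist {h} {t} s∉T refl = sym (trivial h t λ t∈T → s∉T (T-invariant h t t∈T))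

  •-colour : ∀ {h e s} → h • e ≡ zer s → ∃[ t ] e ≡ zer t × act h t ≡ s
  •-colour {e = zer t} refl = t , refl , refl

  move-Paired : ∀ {x p e b} → Move x p e b → Allowed x p e → Paired x → Paired b
  move-Paired {x} {p} {e} {b} M allowed paired s i s∉T eqb with x ! i in eqx
  ... | zer t with trans (sym eqb) (MoveProperties.result-zer M eqx)
  ... | refl with paired s i s∉T eqx
  ... | j , j≢i , eqj = j , j≢i , MoveProperties.result-zer M eqj
  move-Paired {x} {p} {e} {b} M allowed paired s i s∉T eqb | blk r h with r ≟ p
  ... | no r≢p = contradiction (trans (sym eqb) (MoveProperties.result-miss M r≢p eqx)) λ ()
  ... | yes refl with •-colour {h} {e} (trans (sym (MoveProperties.result-hit M eqx)) eqb)
  ... | t , refl , eqs with untwist {h} s∉T eqs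
  ... | refl with i ≟ p
  ... | no i≢p = p , (λ p≡i → i≢p (sym p≡i)) , MoveProperties.result-pos M
  ... | yes refl with allowed s∉T
  ... | j , j≢p , inj₁ eqj = j , j≢p , MoveProperties.result-zer M eqj
  ... | j , j≢p , inj₂ (h′ , eqj) = j , j≢p , trans (MoveProperties.result-hit M eqj) (cong zer (trivial h′ t s∉T))

  moveᴾ : ∀ (x : PElem T) p e → IsMin (el x) p → Target (el x) p e → Allowed (el x) p e
        → Σ (PElem T) λ b → Move (el x) p e (el b)
  moveᴾ x p e min tgt allowed with move (el x) p e min tgt
  ... | b , M = mkP b (Paired⇒InP b (move-Paired M allowed (InP⇒Paired x))) , M

  Allowed-mono : ∀ {x q f b p} e → Move x q f b → p ≢ q → Allowed x p e → Allowed b p e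
  Allowed-mono (blk _ _) M p≢q _ = tt
  Allowed-mono (zer s) M p≢q allowed s∉T with allowed s∉T
  ... | j , j≢p , inj₁ eq       = j , j≢p , inj₁ (MoveProperties.result-zer M eq)
  ... | j , j≢p , inj₂ (h , eq) = j , j≢p , inj₂ (h , MoveProperties.result-miss M p≢q eq)

  -- The absorbed minimum `q` is a second element of the block of `r`.
  Allowed-merged : ∀ {x q r g b} s → Move x q (blk r g) b → Allowed b r (zer s)
  Allowed-merged {q = q} {g = g} s M _ =
    q , (λ { refl → ℕ.<-irrefl refl (proj₁ (Move.target M)) }) , inj₂ (g , MoveProperties.result-pos M)

  -- Labels of the steps

  Occurs : DElem → Fin k → Set
  Occurs x s = ∃[ i ] x ! i ≡ zer s

  Occurs? : ∀ x s → Dec (Occurs x s)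
  Occurs? x s = F.any? λ i → x ! i ≟ᴱ zer s

  -- Always false for T ≠ ∅, since then s₁ ∈ T.
  Reused : DElem → Fin k → Set
  Reused x s = s₁ ∉ T × Occurs x s

  Reused? : ∀ x s → Dec (Reused x s)
  Reused? x s = ¬? (s₁ ∈? T) ×-dec Occurs? x s

  newRank : ∀ s → Dec (s ≡ s₁) → ℕ
  newRank s (yes _) = 0
  -- Rank 1 is reserved for the step to the top.
  newRank s (no _)  = 2 + toℕ s

  colourLabel : ∀ x s → Dec (Reused x s) → Label
  colourLabel x s (yes _) = 1 , toℕ s , 0
  colourLabel x s (no _)  = 2 , newRank s (s ≟ s₁) , 0

  -- A coherent merge is labelled without `r`: at the least possible `p` the partner is unique, as
  -- `CoherentMerge.least` shows.
  mergeLabel : Fin n → Fin n → (g : Fin m) → Dec (g ≡ e₀) → Label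
  mergeLabel p r g (yes _) = 0 , toℕ p , 0
  mergeLabel p r g (no _)  = 3 , toℕ r , toℕ g

  moveLabel : DElem → Fin n → Entry → Label
  moveLabel x p (zer s)   = colourLabel x s (Reused? x s)
  moveLabel x p (blk r g) = mergeLabel p r g (g ≟ e₀)

  OtherColour : DElem → Set
  OtherColour x = s₁ ∉ T × ∃[ i ] ∃[ s ] x ! i ≡ zer s × s ≢ s₁

  OtherColour? : ∀ x → Dec (OtherColour x)
  OtherColour? x = ¬? (s₁ ∈? T) ×-dec F.any? λ i → F.any? λ s → x ! i ≟ᴱ zer s ×-dec ¬? (s ≟ s₁)

  leastColour : ∀ x → (∃[ s ] Occurs x s × (∀ t → Occurs x t → (0 , toℕ s , 0) ≼ (0 , toℕ t , 0)))
                    ⊎ (∀ s → ¬ Occurs x s)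
  leastColour x = argmin (Occurs? x) λ s → 0 , toℕ s , 0

  topLabel : DElem → Label
  topLabel x with OtherColour? x | leastColour x
  -- The last entry 1 puts this just after the colouring label `(1 , toℕ s , 0)`.
  ... | yes _ | inj₁ (s , _) = 1 , toℕ s , 1
  -- A default value: an `OtherColour` occurs, so this case is impossible.
  ... | yes _ | inj₂ _       = 2 , 1 , 0
  ... | no _  | _            = 2 , 1 , 0

  label-reused : ∀ x p s → Reused x s → moveLabel x p (zer s) ≡ (1 , toℕ s , 0)
  label-reused x p s reused with Reused? x s
  ... | yes _ = refl
  ... | no ¬r = contradiction reused ¬r

  label-new : ∀ x p s → ¬ Reused x s → moveLabel x p (zer s) ≡ (2 , newRank s (s ≟ s₁) , 0)
  label-new x p s ¬r with Reused? x s
  ... | yes r = contradiction r ¬r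
  ... | no _  = refl

  newRank-s₁ : newRank s₁ (s₁ ≟ s₁) ≡ 0
  newRank-s₁ with s₁ ≟ s₁
  ... | yes _ = refl
  ... | no ne = contradiction refl ne

  newRank-other : ∀ {s} → s ≢ s₁ → newRank s (s ≟ s₁) ≡ 2 + toℕ s
  newRank-other {s} s≢s₁ with s ≟ s₁
  ... | yes eq = contradiction eq s≢s₁
  ... | no _   = refl

  newRank-injective : ∀ s t → newRank s (s ≟ s₁) ≡ newRank t (t ≟ s₁) → s ≡ t
  newRank-injective s t eq with s ≟ s₁ | t ≟ s₁
  newRank-injective s t eq | yes refl | yes refl = refl
  newRank-injective s t () | yes _ | no _
  newRank-injective s t () | no _ | yes _
  newRank-injective s t eq | no _ | no _ = F.toℕ-injective (ℕ.suc-injective (ℕ.suc-injective eq))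

  label-coherent : ∀ x p r → moveLabel x p (blk r e₀) ≡ (0 , toℕ p , 0)
  label-coherent x p r with e₀ ≟ e₀
  ... | yes _ = refl
  ... | no ne = contradiction refl ne

  label-incoherent : ∀ x p r {g} → g ≢ e₀ → moveLabel x p (blk r g) ≡ (3 , toℕ r , toℕ g)
  label-incoherent x p r {g} g≢e₀ with g ≟ e₀
  ... | yes eq = contradiction eq g≢e₀
  ... | no _   = refl

  colour-≻-0 : ∀ x p s {a b} → (0 , a , b) ≺ moveLabel x p (zer s)
  colour-≻-0 x p s with Reused? x s
  ... | yes _ = by-1st (s≤s z≤n)
  ... | no _  = by-1st (s≤s z≤n)

  colour-≺-3 : ∀ x p s {a b} → moveLabel x p (zer s) ≺ (3 , a , b)
  colour-≺-3 x p s with Reused? x s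
  ... | yes _ = by-1st (s≤s (s≤s z≤n))
  ... | no _  = by-1st (s≤s (s≤s (s≤s z≤n)))

  merge-≺-3 : ∀ x p {r r′ : Fin n} g {b} → r <ᶠ r′ → moveLabel x p (blk r g) ≺ (3 , toℕ r′ , b)
  merge-≺-3 x p g r<r′ with g ≟ e₀
  ... | yes _ = by-1st (s≤s z≤n)
  ... | no _  = by-2nd r<r′

  colour-injective : ∀ x p q s t → moveLabel x p (zer s) ≡ moveLabel x q (zer t) → s ≡ t
  colour-injective x p q s t eq with Reused? x s | Reused? x t
  ... | yes _ | yes _ = F.toℕ-injective (cong (λ l → proj₁ (proj₂ l)) eq)
  ... | no _  | no _  = newRank-injective s t (cong (λ l → proj₁ (proj₂ l)) eq)
  colour-injective x p q s t () | yes _ | no _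
  colour-injective x p q s t () | no _ | yes _

  -- The label changes only by falling from first entry 2 to 1, when `s` comes into use.
  colour-antitone : ∀ x b p q s → (s₁ ∉ T → Occurs x s → Occurs b s) → moveLabel b p (zer s) ≼ moveLabel x q (zer s)
  colour-antitone x b p q s mono with Reused? x s | Reused? b s
  ... | yes _       | yes _ = ≼-refl {1 , toℕ s , 0}
  ... | no _        | no _  = ≼-refl {2 , newRank s (s ≟ s₁) , 0}
  ... | no _        | yes _ = inj₁ (by-1st (s≤s (s≤s z≤n)))
  ... | yes (t , o) | no ¬r = contradiction (t , mono t o) ¬r

  label-top-other : ∀ x → OtherColour x
    → ∃[ s ] Occurs x s × (∀ t → Occurs x t → s ≤ᶠ t) × topLabel x ≡ (1 , toℕ s , 1)
  label-top-other x other with OtherColour? x | leastColour x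
  ... | no ¬o | _ = contradiction other ¬o
  ... | yes _ | inj₁ (s , o , min) = s , o , (λ t o′ → ≼-2nd⁻ (min t o′)) , refl
  ... | yes (_ , i , s , eq , _) | inj₂ none = contradiction (i , eq) (none s)

  label-top-s₁ : ∀ x → ¬ OtherColour x → topLabel x ≡ (2 , 1 , 0)
  label-top-s₁ x ¬o with OtherColour? x | leastColour x
  ... | yes o | _ = contradiction o ¬o
  ... | no _  | _ = refl

  -- Atoms of an interval and the best atom

  Below : P̂ T → Fin n → Entry → Set
  Below (elem y) p e = el y ! p ≡ ext (el y) e
  Below top      p e = ⊤

  Same : P̂ T → Fin n → Fin n → Set
  Same (elem y) r p = el y ! r ≡ el y ! p
  Same top      r p = ⊤

  Same? : ∀ t r p → Dec (Same t r p)
  Same? (elem y) r p = el y ! r ≟ᴱ el y ! p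
  Same? top      r p = yes tt

  Same-sym : ∀ t {r p} → Same t r p → Same t p r
  Same-sym (elem y) eq = sym eq
  Same-sym top      _  = tt

  Same-trans : ∀ t {r p q} → Same t r p → Same t p q → Same t r q
  Same-trans (elem y) eq eq′ = trans eq eq′
  Same-trans top      _  _   = tt

  Same⇒Below : ∀ t {r p} → Same t r p → Below t p (blk r e₀)
  Same⇒Below (elem y) eq = trans (sym eq) (sym (•-ε _))
  Same⇒Below top      _  = tt

  Below⇒Same : ∀ t {r p} → Below t p (blk r e₀) → Same t r p
  Below⇒Same (elem y) eq = sym (trans eq (•-ε _))
  Below⇒Same top      _  = tt

  Below-Same : ∀ t {p q} e → Same t p q → Below t p e → Below t q e
  Below-Same (elem y) e eq below = trans (sym eq) below
  Below-Same top      e _  _     = tt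

  -- `Allowed` is kept apart: `ascent-move` pulls a later step back to `x`, where its result may
  -- leave P, and `Best.least` must still compare its label.
  record Atom (x : DElem) (t : P̂ T) (p : Fin n) (e : Entry) : Set where
    constructor mkAtom
    field
      atom-min    : IsMin x p
      atom-target : Target x p e
      atom-below  : Below t p e
  open Atom

  NoMin : DElem → Set
  NoMin x = ∀ r → ¬ IsMin x r

  data Descent (b : DElem) (t : P̂ T) (ℓ : Label) : Set where
    via : ∀ p e → Atom b t p e → Allowed b p e → moveLabel b p e ≼ ℓ → Descent b t ℓ
    end : t ≡ top → NoMin b → topLabel b ≼ ℓ → Descent b t ℓ

  -- `Greedy` in terms of moves. By `fresh`, no later step uses the colour just introduced, whose
  -- label may have dropped; `last` is the ascent into the top.
  record Best (x : PElem T) (t : P̂ T) : Set where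
    field
      pos     : Fin n
      tgt     : Entry
      isAtom  : Atom (el x) t pos tgt
      allowed : Allowed (el x) pos tgt
      least   : ∀ q f → Atom (el x) t q f
              → (q ≡ pos × f ≡ tgt) ⊎ moveLabel (el x) pos tgt ≺ moveLabel (el x) q f
      fresh   : ∀ q s → Atom (el x) t q (zer s) → tgt ≡ zer s → q ≡ pos
      last    : ∀ a → t ≡ top → Move (el x) pos tgt a → NoMin a → moveLabel (el x) pos tgt ≺ topLabel a
      descent : ∀ q f b → Atom (el x) t q f → Move (el x) q f b → ¬ (q ≡ pos × f ≡ tgt)
              → Descent b t (moveLabel (el x) q f)

  ≺-cast : {a a′ b b′ : Label} → a ≡ a′ → b ≡ b′ → a′ ≺ b′ → a ≺ b
  ≺-cast refl refl lt = lt

  ≺⇒≼-cast : {a a′ b b′ : Label} → a ≡ a′ → b ≡ b′ → a′ ≺ b′ → a ≼ b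
  ≺⇒≼-cast refl refl lt = inj₁ lt

  -- The group acts freely on block entries, whereas colours may have stabilisers.
  •-fixed : ∀ {g r h} → blk r h ≡ g • blk r h → g ≡ e₀
  •-fixed {g} {r} {h} eq = identityˡ-unique g h (sym (proj₂ (blk-injective eq)))

  •-inverse : ∀ g e → (g ⁻¹) • g • e ≡ e
  •-inverse g e = trans (sym (•-∙ (g ⁻¹) g e)) (trans (cong (_• e) (inverseˡ g)) (•-ε e))

  Occurs-move : ∀ {x p e b s} → Move x p e b → Occurs x s → Occurs b s
  Occurs-move M (i , eq) = i , MoveProperties.result-zer M eq

  -- For `T` empty the action is trivial, so a coloured block receives only the colour of `e`.
  Occurs-new : ∀ {x p e b s} → Move x p e b → (∀ t → t ∉ T) → Occurs b s → Occurs x s ⊎ e ≡ zer s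
  Occurs-new {x} {p} {e} M T-∅ (i , eq) with x ! i in eqx
  ... | zer t = inj₁ (i , trans eqx (trans (sym (MoveProperties.result-zer M eqx)) eq))
  ... | blk r h with r ≟ p
  ... | no r≢p = contradiction (trans (sym (MoveProperties.result-miss M r≢p eqx)) eq) λ ()
  ... | yes refl with •-colour {h} {e} (trans (sym (MoveProperties.result-hit M eqx)) eq)
  ... | t , refl , refl = inj₂ (cong zer (sym (trivial h t (T-∅ t))))

  <ᶠ⇒≢ : ∀ {i j : Fin n} → i <ᶠ j → i ≢ j
  <ᶠ⇒≢ i<j refl = ℕ.<-irrefl refl i<j

  -- The greedy step when a coherent merge exists

  module CoherentMerge (x : PElem T) (t : P̂ T) {p r : Fin n}
    (minp : IsMin (el x) p) (minr : IsMin (el x) r) (r<p : r <ᶠ p) (same : Same t r p)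
    (first : ∀ q r′ → IsMin (el x) q → IsMin (el x) r′ → r′ <ᶠ q → Same t r′ q → p ≤ᶠ q)
    where

    least : ∀ q f → Atom (el x) t q f
          → (q ≡ p × f ≡ blk r e₀) ⊎ moveLabel (el x) p (blk r e₀) ≺ moveLabel (el x) q f
    least q (zer s) _ = inj₂ (≺-cast (label-coherent (el x) p r) refl (colour-≻-0 (el x) q s))
    least q (blk r′ g) (mkAtom minq (r′<q , minr′) below) = go (g ≟ e₀)
      where
      go : Dec (g ≡ e₀) → (q ≡ p × blk r′ g ≡ blk r e₀) ⊎ moveLabel (el x) p (blk r e₀) ≺ moveLabel (el x) q (blk r′ g)
      go (no g≢e₀) = inj₂ (≺-cast (label-coherent (el x) p r) (label-incoherent (el x) q r′ g≢e₀) (by-1st (s≤s z≤n)))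
      go (yes refl) with q ≟ p
      ... | no q≢p = inj₂ (≺-cast (label-coherent (el x) p r) (label-coherent (el x) q r′)
                       (by-2nd (F.≤∧≢⇒< (first q r′ minq minr′ r′<q (Below⇒Same t below)) λ p≡q → q≢p (sym p≡q))))
      -- Two different partners of `p` could be merged with each other at an index below `p`,
      -- against the choice of `p`.
      ... | yes refl with F.<-cmp r r′
      ... | tri≈ _ refl _ = inj₁ (refl , refl)
      ... | tri< r<r′ _ _ = contradiction
            (first r′ r minr′ minr r<r′ (Same-trans t same (Same-sym t (Below⇒Same t below)))) (ℕ.<⇒≱ r′<q)
      ... | tri> _ _ r′<r = contradiction
            (first r r′ minr minr′ r′<r (Same-trans t (Below⇒Same t below) (Same-sym t same))) (ℕ.<⇒≱ r<p)

    module _ {q r′ g b} (A : Atom (el x) t q (blk r′ g)) (M : Move (el x) q (blk r′ g) b) (g≢e₀ : g ≢ e₀) where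
      open MoveProperties M using (min-kept)

      private
        r′<q : r′ <ᶠ q
        r′<q = proj₁ (atom-target A)
        minr′ : IsMin b r′
        minr′ = min-kept (proj₂ (atom-target A)) (<ᶠ⇒≢ r′<q)

      colour-merged : ∀ s → Below t r′ (zer s) → Descent b t (moveLabel (el x) q (blk r′ g))
      colour-merged s below = via r′ (zer s) (mkAtom minr′ tt below) (Allowed-merged s M)
        (≺⇒≼-cast refl (label-incoherent (el x) q r′ g≢e₀) (colour-≺-3 b r′ s))

      coherent-left : q ≢ p → q ≢ r → Descent b t (moveLabel (el x) q (blk r′ g))
      coherent-left q≢p q≢r = via p (blk r e₀)
        (mkAtom (min-kept minp λ { refl → q≢p refl }) (r<p , min-kept minr λ { refl → q≢r refl }) (Same⇒Below t same)) tt
        (≺⇒≼-cast (label-coherent b p r) (label-incoherent (el x) q r′ g≢e₀) (by-1st (s≤s z≤n)))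

    -- Since `o` and `q` agree in `y`, the block of `o` joins that of `r′` by the same `g`, or takes
    -- it in by `g ⁻¹` if `o < r′`; neither label exceeds that of the merge. If `o` were `r′`,
    -- freeness would give `g ≡ e₀`.
    rejoin : ∀ y {q r′ g b o r″ h} → t ≡ elem y → Atom (el x) t q (blk r′ g) → Move (el x) q (blk r′ g) b → g ≢ e₀
           → IsMin (el x) o → o ≢ q → Same t o q → el y ! r′ ≡ blk r″ h → Descent b t (moveLabel (el x) q (blk r′ g))
    rejoin y {q} {r′} {g} {b} {o} {r″} {h} refl A M g≢e₀ mino o≢q same′ eqr′ = go (F.<-cmp r′ o)
      where
      open MoveProperties M using (min-kept)
      minr′ : IsMin b r′
      minr′ = min-kept (proj₂ (atom-target A)) (<ᶠ⇒≢ (proj₁ (atom-target A)))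
      eqo : el y ! o ≡ g • el y ! r′
      eqo = trans same′ (atom-below A)
      go : _ → Descent b t (moveLabel (el x) q (blk r′ g))
      go (tri< r′<o _ _) = via o (blk r′ g) (mkAtom (min-kept mino o≢q) (r′<o , minr′) eqo) tt
        (≡⇒≼ (trans (label-incoherent b o r′ g≢e₀) (sym (label-incoherent (el x) q r′ g≢e₀))))
      go (tri≈ _ refl _) = contradiction (•-fixed (trans (sym eqr′) (trans eqo (cong (g •_) eqr′)))) g≢e₀
      go (tri> _ _ o<r′) = via r′ (blk o (g ⁻¹))
        (mkAtom minr′ (o<r′ , min-kept mino o≢q) (trans (sym (•-inverse g (el y ! r′))) (cong ((g ⁻¹) •_) (sym eqo)))) tt
        (≺⇒≼-cast refl (label-incoherent (el x) q r′ g≢e₀) (merge-≺-3 b r′ (g ⁻¹) o<r′))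

    -- A step absorbing neither `p` nor `r` leaves the greedy merge available. If one of them is
    -- coloured, the other takes the same colour next. After an incoherent merge of one, either the
    -- merged block is coloured or the other rejoins it.
    descent : ∀ q f b → Atom (el x) t q f → Move (el x) q f b → ¬ (q ≡ p × f ≡ blk r e₀)
            → Descent b t (moveLabel (el x) q f)
    descent q (zer s) b A M _ with q ≟ p | q ≟ r
    ... | yes refl | _ = via r (zer s)
      (mkAtom (MoveProperties.min-kept M minr (<ᶠ⇒≢ r<p)) tt (Below-Same t (zer s) (Same-sym t same) (atom-below A)))
      (λ _ → p , (λ p≡r → <ᶠ⇒≢ r<p (sym p≡r)) , inj₁ (MoveProperties.result-pos M))
      (colour-antitone (el x) b r p s λ _ → Occurs-move M)
    ... | no _ | yes refl = via p (zer s)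
      (mkAtom (MoveProperties.min-kept M minp (λ p≡r → <ᶠ⇒≢ r<p (sym p≡r))) tt (Below-Same t (zer s) same (atom-below A)))
      (λ _ → r , <ᶠ⇒≢ r<p , inj₁ (MoveProperties.result-pos M))
      (colour-antitone (el x) b p r s λ _ → Occurs-move M)
    ... | no q≢p | no q≢r = via p (blk r e₀)
      (mkAtom (MoveProperties.min-kept M minp λ { refl → q≢p refl })
              (r<p , MoveProperties.min-kept M minr λ { refl → q≢r refl }) (Same⇒Below t same)) tt
      (≺⇒≼-cast (label-coherent b p r) refl (colour-≻-0 (el x) q s))
    descent q (blk r′ g) b A M ne = go (g ≟ e₀)
      where
      go : Dec (g ≡ e₀) → Descent b t (moveLabel (el x) q (blk r′ g))
      go (yes refl) with least q (blk r′ e₀) A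
      ... | inj₁ eq = contradiction eq ne
      ... | inj₂ lt = via p (blk r e₀)
        (mkAtom (MoveProperties.min-kept M minp p≢q) (r<p , MoveProperties.min-kept M minr r≢q) (Same⇒Below t same)) tt (inj₁ lt)
        where
        p≤q : p ≤ᶠ q
        p≤q = first q r′ (atom-min A) (proj₂ (atom-target A)) (proj₁ (atom-target A)) (Below⇒Same t (atom-below A))
        r≢q : r ≢ q
        r≢q = <ᶠ⇒≢ (ℕ.<-≤-trans r<p p≤q)
        p≢q : p ≢ q
        p≢q refl = ≺-irrefl {0 , toℕ p , 0} (refl , refl , refl)
          (≺-cast (sym (label-coherent (el x) p r)) (sym (label-coherent (el x) p r′)) lt)
      go (no g≢e₀) = byTop t refl
        where
        byTop : ∀ t′ → t ≡ t′ → Descent b t (moveLabel (el x) q (blk r′ g))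
        byTop top      refl = colour-merged A M g≢e₀ s₁ tt
        byTop (elem y) refl with el y ! r′ in eqr′
        ... | zer s = colour-merged A M g≢e₀ s eqr′
        ... | blk r″ h with q ≟ p | q ≟ r
        ... | yes refl | _        = rejoin y refl A M g≢e₀ minr (<ᶠ⇒≢ r<p) same eqr′
        ... | no _     | yes refl = rejoin y refl A M g≢e₀ minp (λ p≡r → <ᶠ⇒≢ r<p (sym p≡r)) (sym same) eqr′
        ... | no q≢p   | no q≢r   = coherent-left A M g≢e₀ q≢p q≢r

    best : Best x t
    best = record
      { pos = p ; tgt = blk r e₀ ; isAtom = mkAtom minp (r<p , minr) (Same⇒Below t same) ; allowed = tt
      ; least = least ; fresh = λ { _ _ _ () }
      ; last = λ { a refl M none → contradiction (MoveProperties.min-kept M minr (<ᶠ⇒≢ r<p)) (none r) }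
      ; descent = descent }

  -- The greedy step below an element when no coherent merge exists

  Distinct : DElem → DElem → Set
  Distinct x y = ∀ q r → IsMin x q → IsMin x r → y ! q ≡ y ! r → q ≡ r

  no-coherent : ∀ x (y : PElem T) {q r g} → Distinct x (el y) → Atom x (elem y) q (blk r g) → g ≢ e₀
  no-coherent x y distinct A refl =
    <ᶠ⇒≢ (proj₁ (atom-target A)) (distinct _ _ (proj₂ (atom-target A)) (atom-min A) (Below⇒Same (elem y) (atom-below A)))

  module Colouring (x y : PElem T) (x⊑y : el x ⊑ el y) (distinct : Distinct (el x) (el y)) {p s}
    (minp : IsMin (el x) p) (eqp : el y ! p ≡ zer s)
    (first : ∀ q → IsMin (el x) q → ∀ s′ → el y ! q ≡ zer s′ → moveLabel (el x) p (zer s) ≼ moveLabel (el x) q (zer s′))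
    where

    -- Since `y` is in P, a colour outside `T` has a second carrier `j` in `y`. If `x` leaves `j`
    -- uncoloured, the minimum of its block has value `s` in `y` by `untwist`, so `distinct` makes
    -- it `p`.
    allowed : Allowed (el x) p (zer s)
    allowed s∉T with InP⇒Paired y s p s∉T eqp
    ... | j , j≢p , eqj with el x ! j in eqx
    ... | zer t = j , j≢p , inj₁ (trans eqx (trans (sym (⊑-zer x⊑y eqx)) eqj))
    ... | blk q h with •-colour {h} {el y ! q} (trans (sym (⊑-blk x⊑y eqx)) eqj)
    ... | t , eqt , ht≡s with untwist {h} s∉T ht≡s
    ... | refl with distinct q p (block-min (el x) eqx) minp (trans eqt (sym eqp))
    ... | refl = j , j≢p , inj₂ (h , eqx)

    least : ∀ q f → Atom (el x) (elem y) q f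
          → (q ≡ p × f ≡ zer s) ⊎ moveLabel (el x) p (zer s) ≺ moveLabel (el x) q f
    least q (zer t) A with s ≟ t
    ... | yes refl = inj₁ (distinct q p (atom-min A) minp (trans (atom-below A) (sym eqp)) , refl)
    ... | no s≢t   = inj₂ (≼∧≢⇒≺ (first q (atom-min A) t (atom-below A)) λ eq → s≢t (colour-injective (el x) p q s t eq))
    least q (blk r g) A = inj₂ (≺-cast refl (label-incoherent (el x) q r (no-coherent (el x) y distinct A)) (colour-≺-3 (el x) p s))

    -- If `p` is not absorbed, its colouring remains available. A merge can absorb `p` only into a
    -- block that `y` colours too, and then the merged block is coloured.
    descent : ∀ q f b → Atom (el x) (elem y) q f → Move (el x) q f b → ¬ (q ≡ p × f ≡ zer s)
            → Descent b (elem y) (moveLabel (el x) q f)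
    descent q (zer t) b A M ne = via p (zer s) (mkAtom (MoveProperties.min-kept M minp p≢q) tt eqp)
      (Allowed-mono (zer s) M p≢q allowed)
      (≼-trans (colour-antitone (el x) b p p s λ _ → Occurs-move M) (first q (atom-min A) t (atom-below A)))
      where
      p≢q : p ≢ q
      p≢q refl = ne (refl , trans (sym (atom-below A)) eqp)
    descent q (blk r g) b A M ne with el y ! r in eqr
    ... | zer t = via r (zer t) (mkAtom (MoveProperties.min-kept M (proj₂ (atom-target A)) (<ᶠ⇒≢ (proj₁ (atom-target A)))) tt eqr)
      (Allowed-merged t M)
      (≺⇒≼-cast refl (label-incoherent (el x) q r (no-coherent (el x) y distinct A)) (colour-≺-3 b r t))
    ... | blk r′ h = via p (zer s) (mkAtom (MoveProperties.min-kept M minp p≢q) tt eqp)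
      (Allowed-mono (zer s) M p≢q allowed)
      (≺⇒≼-cast refl (label-incoherent (el x) q r (no-coherent (el x) y distinct A)) (colour-≺-3 b p s))
      where
      p≢q : p ≢ q
      p≢q refl = contradiction (trans (sym eqp) (trans (atom-below A) (cong (g •_) eqr))) λ ()

    best : Best x (elem y)
    best = record
      { pos = p ; tgt = zer s ; isAtom = mkAtom minp tt eqp ; allowed = allowed ; least = least
      ; fresh = λ { q _ A refl → distinct q p (atom-min A) minp (trans (atom-below A) (sym eqp)) }
      ; last = λ _ () ; descent = descent }

  module IncoherentMerge (x y : PElem T) (x⊑y : el x ⊑ el y) (distinct : Distinct (el x) (el y))
    (uncoloured : ∀ q s → IsMin (el x) q → el y ! q ≢ zer s) {p r g}
    (minp : IsMin (el x) p) (eqp : el y ! p ≡ blk r g) (r≢p : r ≢ p)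
    (first : ∀ q → IsMin (el x) q → ∀ r′ g′ → el y ! q ≡ blk r′ g′ → r′ ≢ q → (3 , toℕ r , toℕ g) ≼ (3 , toℕ r′ , toℕ g′))
    where

    minr : IsMin (el y) r
    minr = block-min (el y) eqp

    r<p : r <ᶠ p
    r<p = F.≤∧≢⇒< (block-≤ (el y) eqp) r≢p

    isAtom : Atom (el x) (elem y) p (blk r g)
    isAtom = mkAtom minp (r<p , ⊑-min x⊑y minr) (trans eqp (sym (ext-blk (el y) g minr)))

    g≢e₀ : g ≢ e₀
    g≢e₀ = no-coherent (el x) y distinct isAtom

    -- If `r′` is a minimum of `y`, then `first` applies to `q`. Otherwise `y` has `r′` in the block
    -- of a smaller `r″`, and `first` applies to `r′`.
    least : ∀ q f → Atom (el x) (elem y) q f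
          → (q ≡ p × f ≡ blk r g) ⊎ moveLabel (el x) p (blk r g) ≺ moveLabel (el x) q f
    least q (zer s) A = contradiction (atom-below A) (uncoloured q s (atom-min A))
    least q (blk r′ g′) A with el y ! r′ in eqr′
    ... | zer s = contradiction eqr′ (uncoloured r′ s (proj₂ (atom-target A)))
    ... | blk r″ h with r″ ≟ r′
    ... | no r″≢r′ = inj₂ (≺-cast (label-incoherent (el x) p r g≢e₀) (label-incoherent (el x) q r′ (no-coherent (el x) y distinct A))
            (≼-≺-trans (first r′ (proj₂ (atom-target A)) r″ h eqr′ r″≢r′)
                       (by-2nd (F.≤∧≢⇒< (block-≤ (el y) eqr′) r″≢r′))))
    ... | yes refl = compare (eqq (trans (atom-below A) (ext-blk (el y) g′ (block-min (el y) eqr′))))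
      where
      Goal : Set
      Goal = (q ≡ p × blk r′ g′ ≡ blk r g) ⊎ moveLabel (el x) p (blk r g) ≺ moveLabel (el x) q (blk r′ g′)
      eqq : el y ! q ≡ blk r′ g′ → _
      eqq eq = eq , first q (atom-min A) r′ g′ eq (<ᶠ⇒≢ (proj₁ (atom-target A)))
      compare : el y ! q ≡ blk r′ g′ × (3 , toℕ r , toℕ g) ≼ (3 , toℕ r′ , toℕ g′) → Goal
      compare (eq , inj₁ lt) = inj₂ (≺-cast (label-incoherent (el x) p r g≢e₀)
        (label-incoherent (el x) q r′ (no-coherent (el x) y distinct A)) lt)
      compare (eq , inj₂ (_ , er , eg)) with F.toℕ-injective er | F.toℕ-injective eg
      ... | refl | refl = inj₁ (distinct q p (atom-min A) minp (trans eq (sym eqp)) , refl)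

    -- The minimum `r` of `y` is never absorbed, so if `p` survives, its merge remains. If `p` went
    -- into `r′`, then `r′` lies in the block of `r` in `y`, and merging it there has a smaller
    -- label since `r < r′`.
    descent : ∀ q f b → Atom (el x) (elem y) q f → Move (el x) q f b → ¬ (q ≡ p × f ≡ blk r g)
            → Descent b (elem y) (moveLabel (el x) q f)
    descent q (zer s) b A M ne = contradiction (atom-below A) (uncoloured q s (atom-min A))
    descent q (blk r′ g′) b A M ne = go (p ≟ q)
      where
      open MoveProperties M using (min-kept)
      r′<q : r′ <ᶠ q
      r′<q = proj₁ (atom-target A)
      r≢q : r ≢ q
      r≢q refl with •-target {h = g′} (trans (sym (atom-below A)) minr)
      ... | h , eqr′ = ℕ.<⇒≱ r′<q (block-≤ (el y) eqr′)
      go : Dec (p ≡ q) → Descent b (elem y) (moveLabel (el x) q (blk r′ g′))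
      go (no p≢q) with least q (blk r′ g′) A
      ... | inj₁ eq = contradiction eq ne
      ... | inj₂ lt = via p (blk r g)
        (mkAtom (min-kept minp p≢q) (r<p , min-kept (⊑-min x⊑y minr) r≢q) (atom-below isAtom)) tt (inj₁ lt)
      go (yes refl) with •-target {h = g′} (trans (sym (atom-below A)) eqp)
      ... | h , eqr′ = via r′ (blk r h)
        (mkAtom (min-kept (proj₂ (atom-target A)) (<ᶠ⇒≢ r′<q)) (r<r′ , min-kept (⊑-min x⊑y minr) r≢q)
                (trans eqr′ (sym (ext-blk (el y) h minr)))) tt
        (≺⇒≼-cast refl (label-incoherent (el x) q r′ (no-coherent (el x) y distinct A)) (merge-≺-3 b r′ h r<r′))
        where
        r≢r′ : r ≢ r′
        r≢r′ refl = ne (refl , trans (sym (ext-blk (el y) g′ minr)) (trans (sym (atom-below A)) eqp))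
        r<r′ : r <ᶠ r′
        r<r′ = F.≤∧≢⇒< (block-≤ (el y) eqr′) r≢r′

    best : Best x (elem y)
    best = record
      { pos = p ; tgt = blk r g ; isAtom = isAtom ; allowed = tt ; least = least
      ; fresh = λ { _ _ _ () } ; last = λ _ () ; descent = descent }

  best-merge : ∀ x t → Best x t ⊎ (∀ q r → IsMin (el x) q → IsMin (el x) r → Same t q r → q ≡ r)
  best-merge x t with argmin (λ p → IsMin? (el x) p ×-dec F.any? λ r → r F.<? p ×-dec IsMin? (el x) r ×-dec Same? t r p)
                             (λ p → 0 , toℕ p , 0)
  ... | inj₁ (p , (minp , r , r<p , minr , same) , first) =
        inj₁ (CoherentMerge.best x t minp minr r<p same
               λ q r′ minq minr′ r′<q same′ → ≼-2nd⁻ (first q (minq , r′ , r′<q , minr′ , same′)))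
  ... | inj₂ none = inj₂ distinct
    where
    distinct : ∀ q r → IsMin (el x) q → IsMin (el x) r → Same t q r → q ≡ r
    distinct q r minq minr same with F.<-cmp q r
    ... | tri< q<r _ _ = contradiction (minr , q , q<r , minq , same) (none r)
    ... | tri≈ _ eq _  = eq
    ... | tri> _ _ r<q = contradiction (minq , r , r<q , minr , Same-sym t same) (none q)

  blockLabel : Entry → Label
  -- A default value: `best-below` compares only block entries.
  blockLabel (zer s)   = 3 , 0 , 0
  blockLabel (blk r g) = 3 , toℕ r , toℕ g

  best-below : ∀ x y → el x ⊑ el y → el x ≢ el y → Best x (elem y)
  best-below x y x⊑y x≢y with best-merge x (elem y)
  ... | inj₁ b = b
  ... | inj₂ distinct
    with argmin (λ p → IsMin? (el x) p ×-dec F.any? λ s → el y ! p ≟ᴱ zer s) (λ p → moveLabel (el x) p (el y ! p))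
  ... | inj₁ (p , (minp , s , eqp) , first) =
        Colouring.best x y x⊑y distinct minp eqp λ q minq s′ eqq →
          subst₂ (λ e f → moveLabel (el x) p e ≼ moveLabel (el x) q f) eqp eqq (first q (minq , s′ , eqq))
  ... | inj₂ none
    with argmin (λ p → IsMin? (el x) p ×-dec F.any? λ r → F.any? λ g → el y ! p ≟ᴱ blk r g ×-dec ¬? (r ≟ p))
                (λ p → blockLabel (el y ! p))
  ... | inj₁ (p , (minp , r , g , eqp , r≢p) , first) =
        IncoherentMerge.best x y x⊑y distinct (λ q s minq eqq → none q (minq , s , eqq)) minp eqp r≢p
          λ q minq r′ g′ eqq r′≢q →
          subst₂ (λ e f → blockLabel e ≼ blockLabel f) eqp eqq (first q (minq , r′ , g′ , eqq , r′≢q))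
  ... | inj₂ none′ = contradiction (⊑-mins-≡ x⊑y keep) x≢y
    where
    keep : ∀ p → IsMin (el x) p → IsMin (el y) p
    keep p minp with el y ! p in eqp
    ... | zer s = contradiction (minp , s , eqp) (none p)
    ... | blk r g with r ≟ p
    ... | yes refl = trans (sym eqp) (block-min (el y) eqp)
    ... | no r≢p   = contradiction (minp , r , g , eqp , r≢p) (none′ p)

  another : 2 ≤ n → (p : Fin n) → ∃[ j ] j ≢ p
  another (s≤s (s≤s _)) zero    = suc zero , λ ()
  another (s≤s (s≤s _)) (suc p) = zero , λ ()

  -- The greedy step when one block is left below the top

  module LastBlock (2≤n : 2 ≤ n) (x : PElem T) {p} (minp : IsMin (el x) p) (only : ∀ q → IsMin (el x) q → q ≡ p) where

    Preferred : Fin k → Set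
    Preferred s = (Reused (el x) s × (∀ t → Reused (el x) t → s ≤ᶠ t)) ⊎ (s ≡ s₁ × (∀ t → ¬ Reused (el x) t))

    preferred : ∃ Preferred
    preferred with argmin (Reused? (el x)) (λ s → 0 , toℕ s , 0)
    ... | inj₁ (s , reused , first) = s , inj₁ (reused , λ t r → ≼-2nd⁻ (first t r))
    ... | inj₂ none = s₁ , inj₂ (refl , none)

    no-merge : ∀ {q r g} → ¬ Atom (el x) top q (blk r g)
    no-merge A = <ᶠ⇒≢ (proj₁ (atom-target A)) (trans (only _ (proj₂ (atom-target A))) (sym (only _ (atom-min A))))

    colour-least : ∀ {s} → Preferred s → ∀ q t → t ≢ s → moveLabel (el x) p (zer s) ≺ moveLabel (el x) q (zer t)
    colour-least {s} pref q t t≢s with pref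
    ... | inj₂ (refl , none) = ≺-cast (trans (label-new (el x) p s (none s)) (cong (λ a → 2 , a , 0) newRank-s₁))
            (trans (label-new (el x) q t (none t)) (cong (λ a → 2 , a , 0) (newRank-other t≢s))) (by-2nd (s≤s z≤n))
    ... | inj₁ (reused , first) with Reused? (el x) t
    ... | yes r = ≺-cast (label-reused (el x) p s reused) refl (by-2nd (F.≤∧≢⇒< (first t r) λ s≡t → t≢s (sym s≡t)))
    ... | no ¬r = ≺-cast (label-reused (el x) p s reused) refl (by-1st (s≤s (s≤s z≤n)))

    -- If nothing is reused, `a` has no `OtherColour`, and rank 0 precedes rank 1. If `s` is reused,
    -- the top label is `(2 , 1 , 0)` or `(1 , c , 1)` with `c` at least `s`, and the last entry
    -- breaks a tie.
    colour-last : ∀ {s} → Preferred s → ∀ a → Move (el x) p (zer s) a → moveLabel (el x) p (zer s) ≺ topLabel a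
    colour-last {s} pref a M = go (OtherColour? a) pref
      where
      go : Dec (OtherColour a) → Preferred s → moveLabel (el x) p (zer s) ≺ topLabel a
      go (no ¬o) (inj₁ (reused , _)) =
        ≺-cast (label-reused (el x) p s reused) (label-top-s₁ a ¬o) (by-1st (s≤s (s≤s z≤n)))
      go (no ¬o) (inj₂ (refl , none)) =
        ≺-cast (trans (label-new (el x) p s (none s)) (cong (λ c → 2 , c , 0) newRank-s₁)) (label-top-s₁ a ¬o) (by-2nd (s≤s z≤n))
      go (yes (s₁∉T , i , t , eq , t≢s₁)) (inj₂ (refl , none)) with Occurs-new M (T-empty s₁∉T) (i , eq)
      ... | inj₁ o    = contradiction (s₁∉T , o) (none t)
      ... | inj₂ refl = contradiction refl t≢s₁
      go (yes o@(s₁∉T , _)) (inj₁ (reused , first)) with label-top-other a o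
      ... | t , occ , _ , eq = ≺-cast (label-reused (el x) p s reused) eq (s≤t (Occurs-new M (T-empty s₁∉T) occ))
        where
        s≤t : Occurs (el x) t ⊎ zer s ≡ zer t → (1 , toℕ s , 0) ≺ (1 , toℕ t , 1)
        s≤t (inj₂ refl) = by-3rd (s≤s z≤n)
        s≤t (inj₁ o′) with s ≟ t
        ... | yes refl = by-3rd (s≤s z≤n)
        ... | no s≢t   = by-2nd (F.≤∧≢⇒< (first t (s₁∉T , o′)) s≢t)

    -- If nothing is reused, `t` has rank at least 2. If `s` is reused, `b` carries both `s` and
    -- `t`, one of which is not `s₁`; so the top label is `(1 , c , 1)` with `c ≤ s`, and `t` is
    -- either new or larger than `s`.
    top-≼ : ∀ {s} → Preferred s → ∀ t b → Move (el x) p (zer t) b → t ≢ s → topLabel b ≼ moveLabel (el x) p (zer t)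
    top-≼ {s} pref t b M t≢s with pref
    ... | inj₂ (refl , none) = ≼-trans (top-≼-2 (OtherColour? b)) (≺⇒≼-cast refl label-t (by-2nd (s≤s (s≤s z≤n))))
      where
      label-t : moveLabel (el x) p (zer t) ≡ (2 , 2 + toℕ t , 0)
      label-t = trans (label-new (el x) p t (none t)) (cong (λ a → 2 , a , 0) (newRank-other t≢s))
      top-≼-2 : Dec (OtherColour b) → topLabel b ≼ (2 , 1 , 0)
      top-≼-2 (no ¬o) = ≡⇒≼ (label-top-s₁ b ¬o)
      top-≼-2 (yes o) with label-top-other b o
      ... | _ , _ , _ , eq = ≺⇒≼-cast eq refl (by-1st (s≤s (s≤s z≤n)))
    ... | inj₁ (reused@(s₁∉T , i , eqi) , first) with label-top-other b (s₁∉T , other)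
      where
      other : ∃[ j ] ∃[ c ] b ! j ≡ zer c × c ≢ s₁
      other with t ≟ s₁
      ... | no t≢s₁  = p , t , MoveProperties.result-pos M , t≢s₁
      ... | yes refl = i , s , MoveProperties.result-zer M eqi , λ s≡s₁ → t≢s (sym s≡s₁)
    ... | c , _ , c-min , eq with Reused? (el x) t
    ... | no _  = ≺⇒≼-cast eq refl (by-1st (s≤s (s≤s z≤n)))
    ... | yes r = ≺⇒≼-cast eq refl (by-2nd (ℕ.≤-<-trans (c-min s (i , MoveProperties.result-zer M eqi))
                                                         (F.≤∧≢⇒< (first t r) λ s≡t → t≢s (sym s≡t))))

    module _ {s} (pref : Preferred s) where

      -- A reused colour already has a carrier. Otherwise, if `s₁` is outside `T`, nothing is
      -- coloured, so the last block is all of the index set and `2 ≤ n` gives it a second element.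
      allowed : Allowed (el x) p (zer s)
      allowed s∉T = go pref
        where
        go : Preferred s → ∃[ j ] j ≢ p × (el x ! j ≡ zer s ⊎ ∃[ h ] el x ! j ≡ blk p h)
        go (inj₁ ((_ , j , eqj) , _)) = j , (λ { refl → contradiction (trans (sym minp) eqj) λ () }) , inj₁ eqj
        go (inj₂ (refl , none)) with another 2≤n p
        ... | j , j≢p with el x ! j in eqj
        ... | zer t = contradiction (s∉T , j , eqj) (none t)
        ... | blk q h with only q (block-min (el x) eqj)
        ... | refl = j , j≢p , inj₂ (h , eqj)

      least : ∀ q f → Atom (el x) top q f → (q ≡ p × f ≡ zer s) ⊎ moveLabel (el x) p (zer s) ≺ moveLabel (el x) q f
      least q (blk r g) A = contradiction A no-merge
      least q (zer t)   A with t ≟ s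
      ... | yes refl = inj₁ (only q (atom-min A) , refl)
      ... | no t≢s   = inj₂ (colour-least pref q t t≢s)

      descent : ∀ q f b → Atom (el x) top q f → Move (el x) q f b → ¬ (q ≡ p × f ≡ zer s)
              → Descent b top (moveLabel (el x) q f)
      descent q (blk r g) b A M ne = contradiction A no-merge
      descent q (zer t)   b A M ne with only q (atom-min A)
      ... | refl = end refl none (top-≼ pref t b M λ { refl → ne (refl , refl) })
        where
        none : NoMin b
        none r minr = MoveProperties.min-new-≢ M minr (only r (MoveProperties.min-old M minr))

      best : Best x top
      best = record
        { pos = p ; tgt = zer s ; isAtom = mkAtom minp tt tt ; allowed = allowed ; least = least
        ; fresh = λ q _ A _ → only q (atom-min A) ; last = λ a _ M _ → colour-last pref a M ; descent = descent }

  best-top : 2 ≤ n → ∀ x {p} → IsMin (el x) p → Best x top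
  best-top 2≤n x {p} minp with best-merge x top
  ... | inj₁ b = b
  ... | inj₂ distinct = LastBlock.best 2≤n x minp only (proj₂ (LastBlock.preferred 2≤n x minp only))
    where
    only : ∀ q → IsMin (el x) q → q ≡ p
    only q minq = distinct q p minq minp tt

  -- Order and covers of P with a top adjoined

  infix 4 _⊑̂_
  _⊑̂_ : P̂ T → P̂ T → Set
  _⊑̂_ = _≤̂_ λ x y → el x ⊑ el y

  elem-≢ : ∀ {x y : PElem T} → el x ≢ el y → _≢_ {A = P̂ T} (elem x) (elem y)
  elem-≢ ne refl = ne refl

  el-≢ : ∀ {x y : PElem T} → _≢_ {A = P̂ T} (elem x) (elem y) → el x ≢ el y
  el-≢ ne refl = ne refl

  Below⇒⊑̂ : ∀ {x a : PElem T} t {p e} → Move (el x) p e (el a) → elem x ⊑̂ t → Below t p e → elem a ⊑̂ t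
  Below⇒⊑̂ (elem y) M x⊑y below = MoveProperties.move-below M x⊑y below
  Below⇒⊑̂ top      _ _   _     = tt

  ⊑̂⇒Below : ∀ {x a : PElem T} t {p e} → Move (el x) p e (el a) → elem a ⊑̂ t → Below t p e
  ⊑̂⇒Below (elem y) M a⊑y = MoveProperties.below-value M a⊑y
  ⊑̂⇒Below top      _ _   = tt

  best-move : ∀ {x t} → (B : Best x t) → elem x ⊑̂ t
            → Σ (PElem T) λ a → Move (el x) (Best.pos B) (Best.tgt B) (el a) × elem a ⊑̂ t
  best-move {x} {t} B x⊑t
    with moveᴾ x (Best.pos B) (Best.tgt B) (atom-min (Best.isAtom B)) (atom-target (Best.isAtom B)) (Best.allowed B)
  ... | a , M = a , M , Below⇒⊑̂ t M x⊑t (atom-below (Best.isAtom B))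

  -- Greedy moves stay below `y` and lose a minimum each time, so they end at `y`.
  ⊑⇒≤D : ∀ (x y : PElem T) → el x ⊑ el y → el x ≤D el y
  ⊑⇒≤D x y x⊑y = go x x⊑y (<-wellFounded ∣ minima (el x) ∣)
    where
    go : ∀ x → el x ⊑ el y → Acc _<_ ∣ minima (el x) ∣ → el x ≤D el y
    go x x⊑y (acc rs) with el x ≟ᴰ el y
    ... | yes eq = subst (el x ≤D_) eq ε
    ... | no x≢y with best-move (best-below x y x⊑y x≢y) x⊑y
    ... | a , M , a⊑y = move⇒step M ◅ go a a⊑y (rs (rank-⊑ (MoveProperties.move-⊑ M) (MoveProperties.move-≢ M)))

  infix 4 _≤̂ᴾ_ _⋖ᴾ_
  _≤̂ᴾ_ : P̂ T → P̂ T → Set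
  _≤̂ᴾ_ = _≤P̂_ T

  _⋖ᴾ_ : P̂ T → P̂ T → Set
  _⋖ᴾ_ = _⋖_ _≤̂ᴾ_

  ≤⇒⊑̂ : ∀ s t → s ≤̂ᴾ t → s ⊑̂ t
  ≤⇒⊑̂ (elem x) (elem y) l = ≤D⇒⊑ l
  ≤⇒⊑̂ (elem x) top      _ = tt
  ≤⇒⊑̂ top      top      _ = tt

  ⊑̂⇒≤ : ∀ s t → s ⊑̂ t → s ≤̂ᴾ t
  ⊑̂⇒≤ (elem x) (elem y) l = ⊑⇒≤D x y l
  ⊑̂⇒≤ (elem x) top      _ = tt
  ⊑̂⇒≤ top      top      _ = tt

  ≤̂ᴾ-refl : ∀ {s} → s ≤̂ᴾ s
  ≤̂ᴾ-refl {elem x} = ε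
  ≤̂ᴾ-refl {top}    = tt

  ≤̂ᴾ-trans : ∀ {s t u} → s ≤̂ᴾ t → t ≤̂ᴾ u → s ≤̂ᴾ u
  ≤̂ᴾ-trans {elem _} {elem _} {elem _} l l′ = l ◅◅ l′
  ≤̂ᴾ-trans {elem _} {_}      {top}    _ _ = tt
  ≤̂ᴾ-trans {top}    {top}    {top}    _ _ = tt

  elem-≡ : ∀ {x y : PElem T} → el x ≡ el y → _≡_ {A = P̂ T} (elem x) (elem y)
  elem-≡ {mkP x _} {mkP .x _} refl = refl

  ≤̂ᴾ-antisym : ∀ {s t} → s ≤̂ᴾ t → t ≤̂ᴾ s → s ≡ t
  ≤̂ᴾ-antisym {elem x} {elem y} l l′ = elem-≡ (⊑-antisym (≤D⇒⊑ l) (≤D⇒⊑ l′))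
  ≤̂ᴾ-antisym {top}    {top}    _ _  = refl

  _≟ᴾ_ : DecidableEquality (P̂ T)
  elem x ≟ᴾ elem y = map′ elem-≡ (λ { refl → refl }) (el x ≟ᴰ el y)
  elem x ≟ᴾ top    = no λ ()
  top    ≟ᴾ elem y = no λ ()
  top    ≟ᴾ top    = yes refl

  move-⋖ : ∀ {x b : PElem T} {p e} → Move (el x) p e (el b) → elem x ⋖ᴾ elem b
  move-⋖ {x} {b} M = (move⇒step M ◅ ε , elem-≢ move-≢) , tight
    where
    open MoveProperties M
    tight : ∀ z → _<ₚ_ _≤̂ᴾ_ (elem x) z → _<ₚ_ _≤̂ᴾ_ z (elem b) → ⊥
    tight (elem z) (x≤z , x≢z) (z≤b , z≢b) = move-tight (≤D⇒⊑ x≤z) (el-≢ x≢z) (≤D⇒⊑ z≤b) (el-≢ z≢b)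
    tight top      _           (() , _)

  top-⋖ : ∀ {x : PElem T} → NoMin (el x) → elem x ⋖ᴾ top
  top-⋖ {x} none = (tt , λ ()) , tight
    where
    tight : ∀ z → _<ₚ_ _≤̂ᴾ_ (elem x) z → _<ₚ_ _≤̂ᴾ_ z top → ⊥
    tight (elem z) (x≤z , x≢z) _ with lost-min (≤D⇒⊑ x≤z) (el-≢ x≢z)
    ... | r , minr , _ = none r minr
    tight top      _ (_ , ne) = ne refl

  -- The greedy move from `x` towards `b` stays in P, so it must already reach `b`.
  ⋖-move : ∀ {x b : PElem T} → elem x ⋖ᴾ elem b → ∃[ p ] ∃[ e ] Move (el x) p e (el b)
  ⋖-move {x} {b} ((x≤b , x≢b) , tight) with best-move B (≤D⇒⊑ x≤b)
    where B = best-below x b (≤D⇒⊑ x≤b) (el-≢ x≢b)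
  ... | a , M , a⊑b with el a ≟ᴰ el b
  ... | yes refl = _ , _ , M
  ... | no a≢b   = ⊥-elim (tight (elem a) (proj₁ (move-⋖ M)) (⊑⇒≤D a b a⊑b , elem-≢ a≢b))

  -- A move is read off from its ends: the lost minimum is its position, and the entry there in `b`
  -- its target. The second clause is a default value, never reached for a move.
  entryLabel : ∀ (x b : DElem) → Dec (∃[ p ] IsMin x p × ¬ IsMin b p) → Label
  entryLabel x b (yes (p , _)) = moveLabel x p (b ! p)
  entryLabel x b (no _)        = 0 , 0 , 0

  label : P̂ T → P̂ T → Label
  label (elem x) (elem b) = entryLabel (el x) (el b) (F.any? λ p → IsMin? (el x) p ×-dec ¬? (IsMin? (el b) p))
  label (elem x) top      = topLabel (el x)
  label top      _        = 0 , 0 , 0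

  label-move : ∀ (x b : PElem T) {p e} → Move (el x) p e (el b) → label (elem x) (elem b) ≡ moveLabel (el x) p e
  label-move x b {p} M with F.any? (λ q → IsMin? (el x) q ×-dec ¬? (IsMin? (el b) q))
  ... | no none = contradiction (p , MoveProperties.min M , MoveProperties.min-lost M) none
  ... | yes (q , minq , ¬minq) with MoveProperties.lost-only M minq ¬minq
  ... | refl = cong (moveLabel (el x) p) (MoveProperties.result-pos M)

  open ELCriterion _≤̂ᴾ_ labelPoset label

  ≺⇒≺ᵖ : ∀ {a a′ b b′} → a ≡ a′ → b ≡ b′ → a′ ≺ b′ → a ≺ᵖ b
  ≺⇒≺ᵖ {a} refl refl lt = inj₁ lt , λ eq → ≺-irrefl eq lt

  -- Only colouring labels depend on the element, and they fall only when the colour comes into use;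
  -- the last hypothesis says that the move did not introduce it.
  moveLabel-later : ∀ {x p e a} q f → Move x p e a → (∀ s → f ≡ zer s → e ≢ zer s) → moveLabel x q f ≼ moveLabel a q f
  moveLabel-later q (blk r g) M _ = ≡⇒≼ refl
  moveLabel-later {x} {p} {e} {a} q (zer s) M fresh =
    colour-antitone a x q q s λ s₁∉T occ → old (Occurs-new M (T-empty s₁∉T) occ)
    where
    old : Occurs x s ⊎ e ≡ zer s → Occurs x s
    old (inj₁ o)  = o
    old (inj₂ eq) = contradiction eq (fresh s refl)

  -- Greedy steps in all intervals

  module _ (2≤n : 2 ≤ n) where

    -- While a block remains, `best-top` gives a move inside P strictly below the top.
    ⋖-top : ∀ {x : PElem T} → elem x ⋖ᴾ top → NoMin (el x)
    ⋖-top {x} (_ , tight) r minr with best-move (best-top 2≤n x minr) tt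
    ... | a , M , _ = tight (elem a) (proj₁ (move-⋖ M)) (tt , λ ())

    greedy-best : ∀ {x t} → elem x ⊑̂ t → Best x t → Greedy (elem x) t
    greedy-best {x} {t} x⊑t B with best-move B x⊑t
    ... | a , M , a⊑t = record
      { atom = elem a ; covers = move-⋖ M ; below = ⊑̂⇒≤ (elem a) t a⊑t
      ; least = least′ ; ascent = ascent′ ; descent = descent′ }
      where
      open Best B
      x⋖̸top : ¬ (elem x ⋖ᴾ top)
      x⋖̸top cov = ⋖-top cov pos (atom-min isAtom)

      atom-of : ∀ {b q f} → Move (el x) q f (el b) → elem b ≤̂ᴾ t → Atom (el x) t q f
      atom-of {b} N b≤t = mkAtom (Move.min N) (Move.target N) (⊑̂⇒Below {x} {b} t N (≤⇒⊑̂ (elem b) t b≤t))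

      differ : ∀ {b q f} → Move (el x) q f (el b) → _≢_ {A = P̂ T} (elem b) (elem a) → ¬ (q ≡ pos × f ≡ tgt)
      differ N b≢a (refl , refl) = b≢a (elem-≡ (move-functional N M))

      least′ : ∀ b → elem x ⋖ᴾ b → b ≤̂ᴾ t → b ≢ elem a → label (elem x) (elem a) ≺ᵖ label (elem x) b
      least′ top      cov _   _   = contradiction cov x⋖̸top
      least′ (elem b) cov b≤t b≢a with ⋖-move cov
      ... | q , f , N with least q f (atom-of N b≤t)
      ... | inj₁ eq = contradiction eq (differ N b≢a)
      ... | inj₂ lt = ≺⇒≺ᵖ (label-move x a M) (label-move x b N) lt

      module _ {c q f} (N : Move (el a) q f (el c)) (c≤t : elem c ≤̂ᴾ t) where
        old-target : ∀ f → Target (el a) q f → Target (el x) q f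
        old-target (zer s)   _            = tt
        old-target (blk r g) (r<q , minr) = r<q , MoveProperties.min-old M minr

        old-atom : Atom (el x) t q f
        old-atom = mkAtom (MoveProperties.min-old M (Move.min N)) (old-target f (Move.target N))
                          (⊑̂⇒Below {a} {c} t N (≤⇒⊑̂ (elem c) t c≤t))

        q≢pos : q ≢ pos
        q≢pos = MoveProperties.min-new-≢ M (Move.min N)

        -- The later step is already an atom at `x`, where `least` applies, and passing from `x` to
        -- `a` does not lower its label.
        ascent-move : moveLabel (el x) pos tgt ≺ moveLabel (el a) q f
        ascent-move with least q f old-atom
        ... | inj₁ (q≡pos , _) = contradiction q≡pos q≢pos
        ... | inj₂ lt = ≺-≼-trans lt (moveLabel-later q f M
                λ s f≡ tgt≡ → q≢pos (fresh q s (subst (Atom (el x) t q) f≡ old-atom) tgt≡))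

      ascent′ : ∀ c → elem a ⋖ᴾ c → c ≤̂ᴾ t → label (elem x) (elem a) ≺ᵖ label (elem a) c
      ascent′ top cov c≤t = ≺⇒≺ᵖ (label-move x a M) refl (last (el a) (top-only t c≤t) M (⋖-top cov))
        where
        top-only : ∀ t → top ≤̂ᴾ t → t ≡ top
        top-only top _ = refl
      ascent′ (elem c) cov c≤t with ⋖-move cov
      ... | q , f , N = ≺⇒≺ᵖ (label-move x a M) (label-move a c N) (ascent-move N c≤t)

      descent′ : ∀ b → elem x ⋖ᴾ b → b ≤̂ᴾ t → b ≢ elem a → ∃[ c ] b ⋖ᴾ c × c ≤̂ᴾ t × label b c ≼ label (elem x) b
      descent′ top      cov _   _   = contradiction cov x⋖̸top
      descent′ (elem b) cov b≤t b≢a with ⋖-move cov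
      ... | q , f , N with descent q f (el b) (atom-of N b≤t) N (differ N b≢a)
      ... | end refl none le = top , top-⋖ none , tt , subst (topLabel (el b) ≼_) (sym (label-move x b N)) le
      ... | via p e A ok le with moveᴾ b p e (atom-min A) (atom-target A) ok
      ... | c , K = elem c , move-⋖ K , ⊑̂⇒≤ (elem c) t (Below⇒⊑̂ t K (≤⇒⊑̂ (elem b) t b≤t) (atom-below A))
                  , subst₂ _≼_ (sym (label-move b c K)) (sym (label-move x b N)) le

    greedy : ∀ s t → s ≤̂ᴾ t → s ≢ t → Greedy s t
    greedy (elem x) (elem y) l ne = greedy-best (≤D⇒⊑ l) (best-below x y (≤D⇒⊑ l) (el-≢ ne))
    greedy top      (elem y) () _
    greedy top      top      _ ne = contradiction refl ne
    greedy (elem x) top      _ _ with F.any? (IsMin? (el x))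
    ... | yes (r , minr) = greedy-best tt (best-top 2≤n x minr)
    ... | no none = record
      { atom = top ; covers = top-⋖ noMin ; below = tt
      ; least = λ b cov _ b≢top → contradiction (only b cov) b≢top
      ; ascent = λ { (elem _) ((() , _) , _) ; top ((_ , ne) , _) → contradiction refl ne }
      ; descent = λ b cov _ b≢top → contradiction (only b cov) b≢top }
      where
      noMin : NoMin (el x)
      noMin r minr = none (r , minr)
      only : ∀ b → elem x ⋖ᴾ b → b ≡ top
      only top      _   = refl
      only (elem b) cov with ⋖-move cov
      ... | p , _ , M = contradiction (Move.min M) (noMin p)

    rank : P̂ T → ℕ
    rank (elem x) = suc ∣ minima (el x) ∣
    rank top      = 0

    rank-⋖ : ∀ {s t} → s ⋖ᴾ t → rank t < rank s
    rank-⋖ {elem x} {elem y} ((l , ne) , _) = s≤s (rank-⊑ (≤D⇒⊑ l) (el-≢ ne))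
    rank-⋖ {elem x} {top}    _              = s≤s z≤n
    rank-⋖ {top}    {top}    ((_ , ne) , _) = contradiction refl ne

    shellable : ELShellable _≤̂ᴾ_
    shellable = (elem ⊥ᴾ , top , λ s → ⊑̂⇒≤ (elem ⊥ᴾ) s (bot s) , ⊑̂⇒≤ s top (max s))
              , labelPoset , label
              , greedy-EL _≟ᴾ_ (λ {s} → ≤̂ᴾ-refl {s}) (λ {s} {t} {u} → ≤̂ᴾ-trans {s} {t} {u}) ≤̂ᴾ-antisym rank rank-⋖ greedy
      where
      ⊥ᴾ : PElem T
      ⊥ᴾ = mkP bottom (Paired⇒InP bottom λ s i _ eq → contradiction (trans (sym (bottom-! i)) eq) λ ())
      bot : ∀ s → elem ⊥ᴾ ⊑̂ s
      bot (elem y) = bottom-⊑ (el y)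
      bot top      = tt
      max : ∀ s → s ⊑̂ top
      max (elem _) = tt
      max top      = tt

theoremC : (n : ℕ) → 2 ≤ n → (A : FinGroupAction) → 1 ≤ FinGroupAction.k A
    → (T : Subset (FinGroupAction.k A))
    → (∀ g t → t ∈ T → FinGroupAction.act A g t ∈ T)
    → (∀ g s → s ∉ T → FinGroupAction.act A g s ≡ s)
    → ELShellable (Dowling._≤P̂_ A n T)
theoremC n 2≤n A 1≤k T T-invariant trivial with nonempty? T
-- With `s₁` in `T`, the premise of `T-empty` is false.
... | yes (t , t∈T) = Labelling.shellable A n T T-invariant trivial t (λ t∉T → contradiction t∈T t∉T) 2≤n
... | no empty      = Labelling.shellable A n T T-invariant trivial (fromℕ< 1≤k) (λ _ s s∈T → empty (s , s∈T)) 2≤n
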